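{- Over ZF, the axiom of choice is equivalent to the maximum principle (for all partial orders): for every partial order $\mathbb{P}=(\mathbb{P},\unlhd)$, every $p\in\mathbb{P}$, and every formula $\theta(x)$ of the forcing language of $\mathbb{P}$ (a formula of set theory which may have $\mathbb{P}$-names as parameters), $$p\Vdash\exists x\,\theta(x)\quad\text{iff}\quad\text{there exists a }\mathbb{P}\text{ -name }\tau\text{ such that } p\Vdash\theta(\tau).$$
   Context: For a partial order $(\mathbb{P},\unlhd)$ (smaller elements are stronger conditions), $\mathbb{P}$-names are defined recursively as sets of pairs $(p,\sigma)$ with $p\in\mathbb{P}$ and $\sigma$ a $\mathbb{P}$-name. The relation $p\Vdash\varphi$ is the usual forcing relation, defined in ZF (no choice assumed in the ground model) by recursion on formulas; the existential clause is $$p\Vdash\exists x\,\theta(x)\quad\text{iff}\quad\forall q\unlhd p\;\exists r\unlhd q\;\exists\tau\;\; r\Vdash\theta(\tau),$$ where $p,q,r$ range over $\mathbb{P}$ and $\tau$ ranges over $\mathbb{P}$-names. The maximum principle is understood as a scheme, with one instance for each formula $\theta$. -}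

module Defs where

open import Level using (Level) renaming (suc to lsuc)
open import Data.Fin using (Fin)
open import Data.Nat using (ℕ; suc)
open import Data.Product using (_×_; ∃!; ∃-syntax)
open import Data.Sum using (_⊎_)
open import Data.Vec using (Vec; _∷_; lookup)
open import Data.Vec.Relation.Unary.All using (All)
open import Function.Bundles using (_⇔_)
open import Relation.Binary.PropositionalEquality using (_≡_)
open import Relation.Nullary using (¬_)

infix  8 _`∈_ _`≡_
infixr 6 _`∧_

-- Formulas of set theory with n free variables (de Bruijn indices).  The
-- missing connectives are the usual classical abbreviations, e.g. ∀ is ¬ ∃ ¬.
data Formula (n : ℕ) : Set where
  _`∈_ _`≡_ : Fin n → Fin n → Formula n
  `¬_       : Formula n → Formula n
  _`∧_      : Formula n → Formula n → Formula n
  `∃_       : Formula (suc n) → Formula n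

record Structure (ℓ : Level) : Set (lsuc ℓ) where
  infix 8 _∈_
  field
    Carrier : Set ℓ
    _∈_     : Carrier → Carrier → Set ℓ

-- Everything below is a first-order property of the ∈-structure M: all
-- quantifiers range over elements of M and all "sets", "functions" and
-- "relations" are elements of M.  M need not be well-founded externally.
module _ {ℓ : Level} (M : Structure ℓ) where

  open Structure M

  Sat : ∀ {n} → Formula n → Vec Carrier n → Set ℓ
  Sat (i `∈ j) ρ = lookup ρ i ∈ lookup ρ j
  Sat (i `≡ j) ρ = lookup ρ i ≡ lookup ρ j
  Sat (`¬ φ)   ρ = ¬ Sat φ ρ
  Sat (φ `∧ ψ) ρ = Sat φ ρ × Sat ψ ρ
  Sat (`∃ φ)   ρ = ∃[ x ] Sat φ (x ∷ ρ)

  record ZF : Set ℓ where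
    field
      extensionality : ∀ x y → (∀ z → z ∈ x ⇔ z ∈ y) → x ≡ y
      foundation     : ∀ x → (∃[ y ] y ∈ x) →
                       ∃[ y ] y ∈ x × (∀ z → z ∈ x → ¬ z ∈ y)
      pairing        : ∀ x y → ∃[ z ] x ∈ z × y ∈ z
      union          : ∀ x → ∃[ u ] (∀ y z → z ∈ y → y ∈ x → z ∈ u)
      power          : ∀ x → ∃[ u ] (∀ y → (∀ z → z ∈ y → z ∈ x) → y ∈ u)
      infinity       : ∃[ w ] (∃[ e ] e ∈ w × (∀ z → ¬ z ∈ e)) ×
                       (∀ x → x ∈ w →
                        ∃[ s ] s ∈ w × (∀ z → z ∈ s ⇔ (z ∈ x ⊎ z ≡ x)))
      separation     : ∀ {n} (φ : Formula (suc n)) (ρ : Vec Carrier n) a →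
                       ∃[ b ] (∀ x → x ∈ b ⇔ (x ∈ a × Sat φ (x ∷ ρ)))
      replacement    : ∀ {n} (φ : Formula (suc (suc n))) (ρ : Vec Carrier n) a →
                       (∀ x → x ∈ a → ∃! _≡_ λ y → Sat φ (x ∷ y ∷ ρ)) →
                       ∃[ b ] (∀ x → x ∈ a → ∃[ y ] y ∈ b × Sat φ (x ∷ y ∷ ρ))

  -- z = {x , y}
  IsUnorderedPair : Carrier → Carrier → Carrier → Set ℓ
  IsUnorderedPair z x y = ∀ w → w ∈ z ⇔ (w ≡ x ⊎ w ≡ y)

  -- z = (x , y), as a Kuratowski pair {{x} , {x , y}}
  IsPair : Carrier → Carrier → Carrier → Set ℓ
  IsPair z x y = ∀ w → w ∈ z ⇔ (IsUnorderedPair w x x ⊎ IsUnorderedPair w x y)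

  -- (x , y) ∈ r
  Pair∈ : Carrier → Carrier → Carrier → Set ℓ
  Pair∈ x y r = ∃[ z ] IsPair z x y × z ∈ r

  -- (x , (y , z)) ∈ r
  Triple∈ : Carrier → Carrier → Carrier → Carrier → Set ℓ
  Triple∈ x y z r = ∃[ w ] IsPair w y z × Pair∈ x w r

  Transitive : Carrier → Set ℓ
  Transitive T = ∀ x y → x ∈ y → y ∈ T → x ∈ T

  IsFunctionOn : Carrier → Carrier → Set ℓ
  IsFunctionOn X f =
    (∀ z → z ∈ f → ∃[ x ] ∃[ y ] x ∈ X × IsPair z x y) ×
    (∀ x → x ∈ X → ∃! _≡_ λ y → Pair∈ x y f)

  AC : Set ℓ
  AC = ∀ X → (∀ x → x ∈ X → ∃[ y ] y ∈ x) →
       ∃[ f ] IsFunctionOn X f × (∀ x y → x ∈ X → Pair∈ x y f → y ∈ x)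

  record IsPartialOrder (P R : Carrier) : Set ℓ where
    field
      relation : ∀ z → z ∈ R → ∃[ p ] ∃[ q ] p ∈ P × q ∈ P × IsPair z p q
      reflexive     : ∀ p → p ∈ P → Pair∈ p p R
      transitive    : ∀ p q r → Pair∈ p q R → Pair∈ q r R → Pair∈ p r R
      antisymmetric : ∀ p q → Pair∈ p q R → Pair∈ q p R → p ≡ q

  module Forcing (P R : Carrier) where

    infix 8 _⊴_

    _⊴_ : Carrier → Carrier → Set ℓ
    p ⊴ q = Pair∈ p q R

    -- The recursion "y is a name iff y is a set of pairs (p , σ) with p ∈ P
    -- and σ a name", computed on the transitive set T: N is the set of names
    -- in T.
    NameRecursion : Carrier → Carrier → Set ℓ
    NameRecursion T N = ∀ y → y ∈ T →
      y ∈ N ⇔ (∀ z → z ∈ y → ∃[ p ] ∃[ σ ] p ∈ P × σ ∈ N × IsPair z p σ)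

    IsName : Carrier → Set ℓ
    IsName x = ∃[ T ] ∃[ N ]
      Transitive T × NameRecursion T N × x ∈ T × x ∈ N

    Dom : Carrier → Carrier → Set ℓ
    Dom τ ϑ = ∃[ s ] Pair∈ s ϑ τ

    -- The clause for p ⊩ π ∈ τ, given the relation Eq q σ τ ("q ⊩ σ = τ").
    MemClause : (Carrier → Carrier → Carrier → Set ℓ) →
                Carrier → Carrier → Carrier → Set ℓ
    MemClause Eq p π τ = ∀ q → q ⊴ p →
      ∃[ r ] r ⊴ q × (∃[ s ] ∃[ σ ] Pair∈ s σ τ × r ⊴ s × Eq r π σ)

    -- The clause for p ⊩ σ = τ, given the relation Mem q π τ ("q ⊩ π ∈ τ").
    EqClause : (Carrier → Carrier → Carrier → Set ℓ) →
               Carrier → Carrier → Carrier → Set ℓ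
    EqClause Mem p σ τ = ∀ ϑ → Dom σ ϑ ⊎ Dom τ ϑ → ∀ q → q ⊴ p →
      Mem q ϑ σ ⇔ Mem q ϑ τ

    -- The simultaneous recursion for the two atomic cases, computed on the
    -- transitive set T: E is the set of all (p , (σ , τ)) with p ⊩ σ = τ.
    EqRecursion : Carrier → Carrier → Set ℓ
    EqRecursion T E = ∀ p σ τ → p ∈ P → σ ∈ T → τ ∈ T →
      Triple∈ p σ τ E ⇔
      EqClause (MemClause (λ q x y → Triple∈ q x y E)) p σ τ

    ForcesEq : Carrier → Carrier → Carrier → Set ℓ
    ForcesEq p σ τ = ∃[ T ] ∃[ E ]
      Transitive T × EqRecursion T E × σ ∈ T × τ ∈ T × Triple∈ p σ τ E

    ForcesMem : Carrier → Carrier → Carrier → Set ℓ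
    ForcesMem = MemClause ForcesEq

    Forces : ∀ {n} → Carrier → Formula n → Vec Carrier n → Set ℓ
    Forces p (i `∈ j) ρ = ForcesMem p (lookup ρ i) (lookup ρ j)
    Forces p (i `≡ j) ρ = ForcesEq p (lookup ρ i) (lookup ρ j)
    Forces p (`¬ φ)   ρ = ∀ q → q ⊴ p → ¬ Forces q φ ρ
    Forces p (φ `∧ ψ) ρ = Forces p φ ρ × Forces p ψ ρ
    Forces p (`∃ θ)   ρ = ∀ q → q ⊴ p →
      ∃[ r ] r ⊴ q × (∃[ τ ] IsName τ × Forces r θ (τ ∷ ρ))

  -- The instance of the maximum principle for θ(x), where x is variable 0 and
  -- the other n variables are the places of the name parameters ρ.
  MaximumPrincipleFor : ∀ {n} → Formula (suc n) → Set ℓ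
  MaximumPrincipleFor {n} θ =
    ∀ P R → IsPartialOrder P R → let open Forcing P R in
    ∀ p → p ∈ P → (ρ : Vec Carrier n) → All IsName ρ →
    Forces p (`∃ θ) ρ ⇔ (∃[ τ ] IsName τ × Forces p θ (τ ∷ ρ))

  MaximumPrinciple : Set ℓ
  MaximumPrinciple = ∀ {n} (θ : Formula (suc n)) → MaximumPrincipleFor θ

{-# OPTIONS --safe #-}

-- Maximum principle from choice: choose a maximal antichain A among the
-- conditions below p that decide a witness (by Zermelo's tower argument, inside
-- M), choose a witness τ_r for every r ∈ A, and mix them into the single name
-- {(s , σ) : s ⊴ r and s ⊴ t for some r ∈ A and (t , σ) ∈ τ_r}.  Each r ∈ A forces
-- it to be equal to τ_r.  Choosing the τ_r from a set needs collection, which is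
-- obtained from replacement through the cumulative hierarchy; its levels are
-- characterised without ordinals, following Scott, Potter and Button.
--
-- Choice from the maximum principle: order X ∪ {X} with the x ∈ X as pairwise
-- incompatible atoms below the top X, and let ẋ = {(x , y̌) : y ∈ x ∈ X}.  The top
-- forces ∃ v (v ∈ ẋ); if it forces τ ∈ ẋ, then each atom x forces τ = y̌ for exactly
-- one y ∈ x.
module Submission where

open import Level using (Level) renaming (suc to lsuc)
open import Axiom.ExcludedMiddle using (ExcludedMiddle)
open import Data.Empty using (⊥-elim)
open import Data.Fin using (Fin; zero; suc)
open import Data.Nat using (ℕ; zero; suc; _+_)
open import Data.Product using (_×_; _,_; proj₁; proj₂; ∃-syntax)
open import Data.Sum using (_⊎_; inj₁; inj₂; [_,_]′)
open import Data.Vec using (Vec; []; _∷_; lookup; map)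
open import Data.Vec.Properties using (lookup-map)
open import Data.Vec.Relation.Unary.All using ([]; _∷_)
open import Function.Base using (_∘_; id)
open import Function.Bundles using (_⇔_; mk⇔; Equivalence)
open import Function.Construct.Identity using (⇔-id)
open import Function.Construct.Symmetry using (⇔-sym)
open import Relation.Binary.PropositionalEquality using (_≡_; refl; sym; trans; cong; cong₂; subst)
open import Relation.Nullary using (¬_; yes; no)
open import Defs

open Equivalence using (to; from)

-- `M` may be ill-founded from outside, so Agda offers no induction over its sets: every such
-- induction runs inside `M` and needs its property as a formula. Hence the second syntax `Fml`,
-- whose meaning computes to the intended Agda statement. `Forces` recurses on an external formula,
-- so it becomes definable one formula at a time, which is all that a scheme requires. Two circles
-- have to be broken. That every set lies in a level is proved by collecting levels, while
-- collection relies on that very fact; so witnesses already known to lie in levels are collected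
-- first. And replacing forced equals in a membership needs transitivity of forced equality, which
-- needs that replacement in turn; both are relativised to a class, and a level serves as the class
-- in the induction. For the converse one atomic instance of the scheme suffices, membership in a
-- parameter. The function obtained there is definable from the single name `τ`: below an atom the
-- density quantifiers collapse, and an atom never forces check names of different sets to be equal.

pattern v0 = zero
pattern v1 = suc v0
pattern v2 = suc v1
pattern v3 = suc v2
pattern v4 = suc v3
pattern v5 = suc v4
pattern v6 = suc v5
pattern v7 = suc v6
pattern v8 = suc v7

-- Renaming of variables and definable predicates

lift : ∀ {m n} → (Fin m → Fin n) → Fin (suc m) → Fin (suc n)
lift f zero    = zero
lift f (suc i) = suc (f i)

swap₀₁ : ∀ {n} → Fin (suc (suc n)) → Fin (suc (suc n))
swap₀₁ v0            = v1
swap₀₁ v1            = v0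
swap₀₁ (suc (suc i)) = suc (suc i)

renᶠ : ∀ {m n} → (Fin m → Fin n) → Formula m → Formula n
renᶠ f (i `∈ j) = f i `∈ f j
renᶠ f (i `≡ j) = f i `≡ f j
renᶠ f (`¬ φ)   = `¬ renᶠ f φ
renᶠ f (φ `∧ ψ) = renᶠ f φ `∧ renᶠ f ψ
renᶠ f (`∃ φ)   = `∃ renᶠ (lift f) φ

module Definability {ℓ : Level} (M : Structure ℓ) where
  open Structure M

  lift-lookup : ∀ {m n} {f : Fin m → Fin n} {ρ : Vec Carrier m} {σ : Vec Carrier n} →
    (∀ i → lookup σ (f i) ≡ lookup ρ i) → ∀ {x} i → lookup (x ∷ σ) (lift f i) ≡ lookup (x ∷ ρ) i
  lift-lookup h zero    = refl
  lift-lookup h (suc i) = h i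

  sat-ren : ∀ {m n} (f : Fin m → Fin n) (φ : Formula m) {ρ σ} →
    (∀ i → lookup σ (f i) ≡ lookup ρ i) → Sat M (renᶠ f φ) σ ⇔ Sat M φ ρ
  sat-ren f (i `∈ j) h rewrite h i | h j = ⇔-id _
  sat-ren f (i `≡ j) h rewrite h i | h j = ⇔-id _
  sat-ren f (`¬ φ) h = let a = sat-ren f φ h in mk⇔ (λ k → k ∘ from a) (λ k → k ∘ to a)
  sat-ren f (φ `∧ ψ) h = let a = sat-ren f φ h ; b = sat-ren f ψ h in
    mk⇔ (λ (x , y) → to a x , to b y) (λ (x , y) → from a x , from b y)
  sat-ren f (`∃ φ) h =
    mk⇔ (λ (x , k) → x , to (sat-ren (lift f) φ (lift-lookup h)) k)
        (λ (x , k) → x , from (sat-ren (lift f) φ (lift-lookup h)) k)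

  ≡⇒⇔ : {A B : Set ℓ} → A ≡ B → A ⇔ B
  ≡⇒⇔ refl = ⇔-id _

  Pred : ℕ → Set (lsuc ℓ)
  Pred zero    = Set ℓ
  Pred (suc k) = Carrier → Pred k

  apply : ∀ {k} → Pred k → Vec Carrier k → Set ℓ
  apply P []      = P
  apply P (x ∷ ρ) = apply (P x) ρ

  -- Packaging the formula with its predicate lets the predicate be an atom of later formulas
  -- without being unfolded.
  record Definable {k} (P : Pred k) : Set (lsuc ℓ) where
    field
      formula : Formula k
      correct : ∀ ρ → Sat M formula ρ ⇔ apply P ρ

  open Definable

  -- Continuation-passing, so that at P is ρ reduces to P applied to the elements
  -- of ρ themselves rather than to unevaluated lookups.
  lookupK : ∀ {n} → Vec Carrier n → Fin n → (Carrier → Set ℓ) → Set ℓ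
  lookupK (x ∷ ρ) zero    k = k x
  lookupK (x ∷ ρ) (suc i) k = lookupK ρ i k

  at : ∀ {k n} → Pred k → Vec (Fin n) k → Vec Carrier n → Set ℓ
  at P []       ρ = P
  at P (i ∷ is) ρ = lookupK ρ i λ x → at (P x) is ρ

  lookupK≡ : ∀ {n} (ρ : Vec Carrier n) i k → lookupK ρ i k ≡ k (lookup ρ i)
  lookupK≡ (x ∷ ρ) zero    k = refl
  lookupK≡ (x ∷ ρ) (suc i) k = lookupK≡ ρ i k

  at≡ : ∀ {k n} (P : Pred k) (is : Vec (Fin n) k) ρ → at P is ρ ≡ apply P (map (lookup ρ) is)
  at≡ P []       ρ = refl
  at≡ P (i ∷ is) ρ = trans (lookupK≡ ρ i _) (at≡ (P (lookup ρ i)) is ρ)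

  at-ren : ∀ {k m n} (P : Pred k) (is : Vec (Fin m) k) (f : Fin m → Fin n) {ρ σ} →
    (∀ i → lookup σ (f i) ≡ lookup ρ i) → at P (map f is) σ ≡ at P is ρ
  at-ren P []       f h = refl
  at-ren P (i ∷ is) f {ρ} {σ} h = trans (lookupK≡ σ (f i) _)
    (trans (cong (λ x → at (P x) (map f is) σ) (h i))
    (trans (at-ren (P (lookup ρ i)) is f h) (sym (lookupK≡ ρ i _))))

  infix  7 ¬̇_ ∃̇_ ∀̇_
  infixr 6 _∧̇_
  infixr 5 _∨̇_
  infixr 4 _⇒̇_
  infix  3 _⇔̇_

  -- All connectives are primitive, unlike in `Formula`, so that `⟦_⟧` reduces to the statement as
  -- it would be written by hand; this is why most uses of `define` below are justified by
  -- `mk⇔ id id`.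
  data Fml (n : ℕ) : Set (lsuc ℓ) where
    atom             : ∀ {k} {P : Pred k} → Definable P → Vec (Fin n) k → Fml n
    ¬̇_               : Fml n → Fml n
    _∧̇_ _∨̇_ _⇒̇_ _⇔̇_ : Fml n → Fml n → Fml n
    ∃̇_ ∀̇_           : Fml (suc n) → Fml n

  ⌜_⌝ : ∀ {n} → Fml n → Formula n
  ⌜ atom d is ⌝ = renᶠ (lookup is) (formula d)
  ⌜ ¬̇ φ ⌝   = `¬ ⌜ φ ⌝
  ⌜ φ ∧̇ ψ ⌝ = ⌜ φ ⌝ `∧ ⌜ ψ ⌝
  ⌜ φ ∨̇ ψ ⌝ = `¬ (`¬ ⌜ φ ⌝ `∧ `¬ ⌜ ψ ⌝)
  ⌜ φ ⇒̇ ψ ⌝ = `¬ (⌜ φ ⌝ `∧ `¬ ⌜ ψ ⌝)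
  ⌜ φ ⇔̇ ψ ⌝ = `¬ (⌜ φ ⌝ `∧ `¬ ⌜ ψ ⌝) `∧ `¬ (⌜ ψ ⌝ `∧ `¬ ⌜ φ ⌝)
  ⌜ ∃̇ φ ⌝   = `∃ ⌜ φ ⌝
  ⌜ ∀̇ φ ⌝   = `¬ `∃ `¬ ⌜ φ ⌝

  ⟦_⟧ : ∀ {n} → Fml n → Vec Carrier n → Set ℓ
  ⟦ atom {P = P} d is ⟧ ρ = at P is ρ
  ⟦ ¬̇ φ ⟧   ρ = ¬ ⟦ φ ⟧ ρ
  ⟦ φ ∧̇ ψ ⟧ ρ = ⟦ φ ⟧ ρ × ⟦ ψ ⟧ ρ
  ⟦ φ ∨̇ ψ ⟧ ρ = ⟦ φ ⟧ ρ ⊎ ⟦ ψ ⟧ ρ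
  ⟦ φ ⇒̇ ψ ⟧ ρ = ⟦ φ ⟧ ρ → ⟦ ψ ⟧ ρ
  ⟦ φ ⇔̇ ψ ⟧ ρ = ⟦ φ ⟧ ρ ⇔ ⟦ ψ ⟧ ρ
  ⟦ ∃̇ φ ⟧   ρ = ∃[ x ] ⟦ φ ⟧ (x ∷ ρ)
  ⟦ ∀̇ φ ⟧   ρ = ∀ x → ⟦ φ ⟧ (x ∷ ρ)

  ren : ∀ {m n} → (Fin m → Fin n) → Fml m → Fml n
  ren f (atom d is) = atom d (map f is)
  ren f (¬̇ φ)   = ¬̇ ren f φ
  ren f (φ ∧̇ ψ) = ren f φ ∧̇ ren f ψ
  ren f (φ ∨̇ ψ) = ren f φ ∨̇ ren f ψ
  ren f (φ ⇒̇ ψ) = ren f φ ⇒̇ ren f ψ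
  ren f (φ ⇔̇ ψ) = ren f φ ⇔̇ ren f ψ
  ren f (∃̇ φ)   = ∃̇ ren (lift f) φ
  ren f (∀̇ φ)   = ∀̇ ren (lift f) φ

  ⟦ren⟧ : ∀ {m n} (f : Fin m → Fin n) (φ : Fml m) {ρ σ} →
    (∀ i → lookup σ (f i) ≡ lookup ρ i) → ⟦ ren f φ ⟧ σ ⇔ ⟦ φ ⟧ ρ
  ⟦ren⟧ f (atom {P = P} d is) h = ≡⇒⇔ (at-ren P is f h)
  ⟦ren⟧ f (¬̇ φ) h = let a = ⟦ren⟧ f φ h in mk⇔ (λ k → k ∘ from a) (λ k → k ∘ to a)
  ⟦ren⟧ f (φ ∧̇ ψ) h = let a = ⟦ren⟧ f φ h ; b = ⟦ren⟧ f ψ h in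
    mk⇔ (λ (x , y) → to a x , to b y) (λ (x , y) → from a x , from b y)
  ⟦ren⟧ f (φ ∨̇ ψ) h = let a = ⟦ren⟧ f φ h ; b = ⟦ren⟧ f ψ h in
    mk⇔ [ inj₁ ∘ to a , inj₂ ∘ to b ]′ [ inj₁ ∘ from a , inj₂ ∘ from b ]′
  ⟦ren⟧ f (φ ⇒̇ ψ) h = let a = ⟦ren⟧ f φ h ; b = ⟦ren⟧ f ψ h in
    mk⇔ (λ k → to b ∘ k ∘ from a) (λ k → from b ∘ k ∘ to a)
  ⟦ren⟧ f (φ ⇔̇ ψ) h = let a = ⟦ren⟧ f φ h ; b = ⟦ren⟧ f ψ h in
    mk⇔ (λ k → mk⇔ (to b ∘ to k ∘ from a) (to a ∘ from k ∘ from b))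
        (λ k → mk⇔ (from b ∘ to k ∘ to a) (from a ∘ from k ∘ to b))
  ⟦ren⟧ f (∃̇ φ) h =
    mk⇔ (λ (x , k) → x , to (⟦ren⟧ (lift f) φ (lift-lookup h)) k)
        (λ (x , k) → x , from (⟦ren⟧ (lift f) φ (lift-lookup h)) k)
  ⟦ren⟧ f (∀̇ φ) h =
    mk⇔ (λ k x → to (⟦ren⟧ (lift f) φ (lift-lookup h)) (k x))
        (λ k x → from (⟦ren⟧ (lift f) φ (lift-lookup h)) (k x))

  infix 8 _∈̇_ _≡̇_ _⊆̇_

  _∈̇_ _≡̇_ _⊆̇_ : ∀ {n} → Fin n → Fin n → Fml n
  i ∈̇ j = atom {P = _∈_} (record { formula = v0 `∈ v1 ; correct = λ { (_ ∷ _ ∷ []) → ⇔-id _ } }) (i ∷ j ∷ [])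
  i ≡̇ j = atom {P = _≡_} (record { formula = v0 `≡ v1 ; correct = λ { (_ ∷ _ ∷ []) → ⇔-id _ } }) (i ∷ j ∷ [])
  x ⊆̇ y = ∀̇ (v0 ∈̇ suc x ⇒̇ v0 ∈̇ suc y)

-- Elementary set theory inside `M`

module Sets {ℓ : Level} (em : ExcludedMiddle ℓ) (M : Structure ℓ) (zf : ZF M) where
  open Structure M public
  open ZF zf public
  open Definability M public

  dne : {A : Set ℓ} → ¬ ¬ A → A
  dne {A} nn with em {A}
  ... | yes a = a
  ... | no na = ⊥-elim (nn na)

  -- Excluded middle enters for disjunction, implication, equivalence and the universal quantifier,
  -- which `⌜_⌝` expresses through negation.
  sat⇔ : ∀ {n} (φ : Fml n) ρ → Sat M ⌜ φ ⌝ ρ ⇔ ⟦ φ ⟧ ρ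
  sat⇔ (atom {P = P} d is) ρ = mk⇔ (from e ∘ to c ∘ to r) (from r ∘ from c ∘ to e)
    where
    e = ≡⇒⇔ (at≡ P is ρ)
    c = Definable.correct d (map (lookup ρ) is)
    r = sat-ren (lookup is) (Definable.formula d) (λ i → sym (lookup-map i (lookup ρ) is))
  sat⇔ (¬̇ φ) ρ = mk⇔ (λ h a → h (from (sat⇔ φ ρ) a)) (λ h a → h (to (sat⇔ φ ρ) a))
  sat⇔ (φ ∧̇ ψ) ρ = mk⇔ (λ (a , b) → to (sat⇔ φ ρ) a , to (sat⇔ ψ ρ) b)
                        (λ (a , b) → from (sat⇔ φ ρ) a , from (sat⇔ ψ ρ) b)
  sat⇔ (φ ∨̇ ψ) ρ = mk⇔
    (λ h → dne λ k → h ((λ a → k (inj₁ (to (sat⇔ φ ρ) a))) , λ b → k (inj₂ (to (sat⇔ ψ ρ) b))))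
    (λ { (inj₁ a) (na , nb) → na (from (sat⇔ φ ρ) a) ; (inj₂ b) (na , nb) → nb (from (sat⇔ ψ ρ) b) })
  sat⇔ (φ ⇒̇ ψ) ρ = mk⇔
    (λ h a → dne λ k → h (from (sat⇔ φ ρ) a , λ b → k (to (sat⇔ ψ ρ) b)))
    (λ h (a , nb) → nb (from (sat⇔ ψ ρ) (h (to (sat⇔ φ ρ) a))))
  sat⇔ (φ ⇔̇ ψ) ρ = mk⇔
    (λ (h , k) → mk⇔ (λ a → dne λ nb → h (from (sat⇔ φ ρ) a , λ b → nb (to (sat⇔ ψ ρ) b)))
                      (λ b → dne λ na → k (from (sat⇔ ψ ρ) b , λ a → na (to (sat⇔ φ ρ) a))))
    (λ h → (λ (a , nb) → nb (from (sat⇔ ψ ρ) (to h (to (sat⇔ φ ρ) a)))) ,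
           (λ (b , na) → na (from (sat⇔ φ ρ) (from h (to (sat⇔ ψ ρ) b)))))
  sat⇔ (∃̇ φ) ρ = mk⇔ (λ (x , a) → x , to (sat⇔ φ (x ∷ ρ)) a) (λ (x , a) → x , from (sat⇔ φ (x ∷ ρ)) a)
  sat⇔ (∀̇ φ) ρ = mk⇔ (λ h x → dne λ k → h (x , λ a → k (to (sat⇔ φ (x ∷ ρ)) a)))
                      (λ h (x , na) → na (from (sat⇔ φ (x ∷ ρ)) (h x)))

  define : ∀ {k} (φ : Fml k) {P : Pred k} → (∀ ρ → ⟦ φ ⟧ ρ ⇔ apply P ρ) → Definable P
  define φ h = record { formula = ⌜ φ ⌝ ; correct = λ ρ → mk⇔ (to (h ρ) ∘ to (sat⇔ φ ρ)) (from (sat⇔ φ ρ) ∘ from (h ρ)) }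

  upairᶠ pairᶠ pair∈ᶠ : ∀ {n} → Fin n → Fin n → Fin n → Fml n
  upairᶠ z x y = atom {P = IsUnorderedPair M} (define (∀̇ (v0 ∈̇ v1 ⇔̇ (v0 ≡̇ v2 ∨̇ v0 ≡̇ v3)))
    λ { (z ∷ x ∷ y ∷ []) → mk⇔ id id }) (z ∷ x ∷ y ∷ [])
  pairᶠ z x y = atom {P = IsPair M} (define (∀̇ (v0 ∈̇ v1 ⇔̇ (upairᶠ v0 v2 v2 ∨̇ upairᶠ v0 v2 v3)))
    λ { (z ∷ x ∷ y ∷ []) → mk⇔ id id }) (z ∷ x ∷ y ∷ [])
  pair∈ᶠ x y r = atom {P = Pair∈ M} (define (∃̇ (pairᶠ v0 v1 v2 ∧̇ v0 ∈̇ v3))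
    λ { (x ∷ y ∷ r ∷ []) → mk⇔ id id }) (x ∷ y ∷ r ∷ [])

  triple∈ᶠ : ∀ {n} → Fin n → Fin n → Fin n → Fin n → Fml n
  triple∈ᶠ x y z r = atom {P = Triple∈ M} (define (∃̇ (pairᶠ v0 v2 v3 ∧̇ pair∈ᶠ v1 v0 v4))
    λ { (x ∷ y ∷ z ∷ r ∷ []) → mk⇔ id id }) (x ∷ y ∷ z ∷ r ∷ [])

  transitiveᶠ : ∀ {n} → Fin n → Fml n
  transitiveᶠ T = atom {P = Transitive M} (define (∀̇ ∀̇ (v1 ∈̇ v0 ⇒̇ v0 ∈̇ v2 ⇒̇ v1 ∈̇ v2))
    λ { (T ∷ []) → mk⇔ id id }) (T ∷ [])

  infix 8 _⊆_

  _⊆_ : Carrier → Carrier → Set ℓ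
  x ⊆ y = ∀ z → z ∈ x → z ∈ y

  infixr 6 _∪_

  ext : ∀ {x y} → x ⊆ y → y ⊆ x → x ≡ y
  ext h k = extensionality _ _ λ z → mk⇔ (h z) (k z)

  opaque
    sep : ∀ {n} (φ : Fml (suc n)) ρ a → ∃[ b ] (∀ x → x ∈ b ⇔ (x ∈ a × ⟦ φ ⟧ (x ∷ ρ)))
    sep φ ρ a with separation ⌜ φ ⌝ ρ a
    ... | b , h = b , λ x → mk⇔
      (λ i → let j , k = to (h x) i in j , to (sat⇔ φ _) k)
      (λ (j , k) → from (h x) (j , from (sat⇔ φ _) k))

  opaque
    repl : ∀ {n} (φ : Fml (suc (suc n))) ρ a →
           (∀ x → x ∈ a → ∃[ y ] ⟦ φ ⟧ (x ∷ y ∷ ρ)) →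
           (∀ x y z → x ∈ a → ⟦ φ ⟧ (x ∷ y ∷ ρ) → ⟦ φ ⟧ (x ∷ z ∷ ρ) → y ≡ z) →
           ∃[ b ] (∀ x → x ∈ a → ∃[ y ] y ∈ b × ⟦ φ ⟧ (x ∷ y ∷ ρ))
    repl φ ρ a ex un
      with replacement ⌜ φ ⌝ ρ a
             (λ x i → let y , h = ex x i in y , from (sat⇔ φ _) h ,
                      λ {z} k → un x y z i h (to (sat⇔ φ _) k))
    ... | b , h = b , λ x i → let y , j , k = h x i in y , j , to (sat⇔ φ _) k

  opaque
    upair : ∀ x y → ∃[ z ] IsUnorderedPair M z x y
    upair x y with pairing x y
    ... | p , i , j with sep (v0 ≡̇ v1 ∨̇ v0 ≡̇ v2) (x ∷ y ∷ []) p
    ... | z , h = z , λ w → mk⇔ (λ k → proj₂ (to (h w) k))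
                                 λ { (inj₁ refl) → from (h w) (i , inj₁ refl)
                                   ; (inj₂ refl) → from (h w) (j , inj₂ refl) }

  upair-unique : ∀ {z z' x y} → IsUnorderedPair M z x y → IsUnorderedPair M z' x y → z ≡ z'
  upair-unique h k = ext (λ w i → from (k w) (to (h w) i)) (λ w i → from (h w) (to (k w) i))

  opaque
    pair-exists : ∀ x y → ∃[ z ] IsPair M z x y
    pair-exists x y with upair x x | upair x y
    ... | s , hs | t , ht with upair s t
    ... | z , h = z , λ w → mk⇔
      (λ i → [ (λ { refl → inj₁ hs }) , (λ { refl → inj₂ ht }) ]′ (to (h w) i))
      (λ { (inj₁ k) → from (h w) (inj₁ (upair-unique k hs))
         ; (inj₂ k) → from (h w) (inj₂ (upair-unique k ht)) })

  pair-injective : ∀ {z x y x' y'} → IsPair M z x y → IsPair M z x' y' → x ≡ x' × y ≡ y'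
  pair-injective {z} {x} {y} {x'} {y'} h k = eq₁ , eq₂
    where
    sx : ∃[ z ] IsUnorderedPair M z x x
    sx = upair x x
    eq₁ : x ≡ x'
    eq₁ with to (k (proj₁ sx)) (from (h _) (inj₁ (proj₂ sx)))
    ... | inj₁ u = [ id , id ]′ (to (u x) (from (proj₂ sx x) (inj₁ refl)))
    ... | inj₂ u = sym ([ id , id ]′ (to (proj₂ sx x') (from (u x') (inj₁ refl))))
    -- The member `{x , y}` of `z` must be `{x}` or `{x , y'}`; using this in both directions covers
    -- the degenerate pair `{{x}}`.
    half : ∀ {x y y'} → IsPair M z x y → IsPair M z x y' → y ≡ x ⊎ y ≡ y'
    half {x} {y} h k with upair x y
    ... | s , e with to (k s) (from (h s) (inj₂ e))
    ... | inj₁ u = inj₁ ([ id , id ]′ (to (u y) (from (e y) (inj₂ refl))))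
    ... | inj₂ u = to (u y) (from (e y) (inj₂ refl))
    eq₂ : y ≡ y'
    eq₂ with eq₁
    ... | refl with half h k | half k h
    ... | inj₂ e | _ = e
    ... | inj₁ e | inj₁ e' = trans e (sym e')
    ... | inj₁ e | inj₂ e' = sym e'

  opaque
    ⋃ : ∀ x → ∃[ u ] (∀ z → z ∈ u ⇔ (∃[ y ] z ∈ y × y ∈ x))
    ⋃ x with union x
    ... | u , h with sep (∃̇ (v1 ∈̇ v0 ∧̇ v0 ∈̇ v2)) (x ∷ []) u
    ... | v , k = v , λ z → mk⇔ (λ i → proj₂ (to (k z) i))
                                λ (y , i , j) → from (k z) (h y z i j , y , i , j)

  opaque
    ℘ : ∀ x → ∃[ u ] (∀ z → z ∈ u ⇔ z ⊆ x)
    ℘ x with power x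
    ... | u , h with sep (v0 ⊆̇ v1) (x ∷ []) u
    ... | v , k = v , λ z → mk⇔ (λ i → proj₂ (to (k z) i)) λ s → from (k z) (h z s , s)

  opaque
    _∪_ : ∀ x y → ∃[ u ] (∀ z → z ∈ u ⇔ (z ∈ x ⊎ z ∈ y))
    x ∪ y with upair x y
    ... | p , h with ⋃ p
    ... | u , k = u , λ z → mk⇔
      (λ i → let w , j , l = to (k z) i in [ (λ { refl → inj₁ j }) , (λ { refl → inj₂ j }) ]′ (to (h w) l))
      [ (λ j → from (k z) (x , j , from (h x) (inj₁ refl))) , (λ j → from (k z) (y , j , from (h y) (inj₂ refl))) ]′

  opaque
    insert : ∀ x a → ∃[ u ] (∀ z → z ∈ u ⇔ (z ∈ x ⊎ z ≡ a))
    insert x a with upair a a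
    ... | s , h with x ∪ s
    ... | u , k = u , λ z → mk⇔
      (λ i → [ inj₁ , (λ j → inj₂ ([ id , id ]′ (to (h z) j))) ]′ (to (k z) i))
      [ (λ j → from (k z) (inj₁ j)) , (λ j → from (k z) (inj₂ (from (h z) (inj₁ j)))) ]′

  ∈-irrefl : ∀ x → ¬ x ∈ x
  ∈-irrefl x i with upair x x
  ... | s , h with foundation s (x , from (h x) (inj₁ refl))
  ... | y , j , k with [ id , id ]′ (to (h y) j)
  ... | refl = k x j i

  ∈-asym : ∀ x y → x ∈ y → ¬ y ∈ x
  ∈-asym x y i j with upair x y
  ... | s , h with foundation s (x , from (h x) (inj₁ refl))
  ... | z , k , l with to (h z) k
  ... | inj₁ refl = l y (from (h y) (inj₂ refl)) j
  ... | inj₂ refl = l x (from (h x) (inj₁ refl)) i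

  pair-transitive : ∀ {T z x y} → Transitive M T → IsPair M z x y → z ∈ T → x ∈ T × y ∈ T
  pair-transitive {T} {z} {x} {y} tr p i =
    let s , h = upair x y ; sT = tr _ _ (from (p s) (inj₂ h)) i in
    tr _ _ (from (h x) (inj₁ refl)) sT , tr _ _ (from (h y) (inj₂ refl)) sT

  pair∈-transitive : ∀ {T x y r} → Transitive M T → Pair∈ M x y r → r ∈ T → x ∈ T × y ∈ T
  pair∈-transitive tr (z , p , i) j = pair-transitive tr p (tr _ _ i j)

  opaque
    relation : ∀ {n} (φ : Fml (suc (suc n))) ρ A B →
      ∃[ r ] (∀ z → z ∈ r → ∃[ x ] ∃[ y ] x ∈ A × y ∈ B × IsPair M z x y) ×
             (∀ x y → Pair∈ M x y r ⇔ (x ∈ A × y ∈ B × ⟦ φ ⟧ (x ∷ y ∷ ρ)))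
    relation φ ρ A B with A ∪ B
    ... | C , hC with ℘ C
    ... | D , hD with ℘ D
    ... | E , hE with sep (∃̇ ∃̇ (v1 ∈̇ v3 ∧̇ v0 ∈̇ v4 ∧̇ pairᶠ v2 v1 v0)) (A ∷ B ∷ []) E
    -- The second coordinate is quantified first, so that the coordinates occupy `v0` and `v1` as
    -- `φ` expects and only `z` is inserted before the parameters.
    ... | F , hF with sep (∃̇ ∃̇ (pairᶠ v2 v0 v1 ∧̇ ren (lift (lift suc)) φ)) ρ F
    ... | r , hr = r , (λ z i → proj₂ (to (hF z) (proj₁ (to (hr z) i)))) , λ x y → mk⇔ fwd bwd
      where
      weaken : ∀ {x y z} → ⟦ ren (lift (lift suc)) φ ⟧ (x ∷ y ∷ z ∷ ρ) ⇔ ⟦ φ ⟧ (x ∷ y ∷ ρ)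
      weaken = ⟦ren⟧ (lift (lift suc)) φ λ { zero → refl ; (suc zero) → refl ; (suc (suc i)) → refl }
      fwd : ∀ {x y} → Pair∈ M x y r → x ∈ A × y ∈ B × ⟦ φ ⟧ (x ∷ y ∷ ρ)
      fwd {x} {y} (z , p , i) with to (hr z) i
      ... | j , y₁ , x₁ , p₁ , q with to (hF z) j
      ... | _ , x₂ , y₂ , a , b , p₂ with pair-injective p p₁ | pair-injective p p₂
      ... | refl , refl | refl , refl = a , b , to weaken q
      bwd : ∀ {x y} → x ∈ A × y ∈ B × ⟦ φ ⟧ (x ∷ y ∷ ρ) → Pair∈ M x y r
      bwd {x} {y} (a , b , q) with pair-exists x y
      ... | z , p = z , p , from (hr z) (from (hF z) (from (hE z) z⊆ , x , y , a , b , p) ,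
                                         y , x , p , from weaken q)
        where
        C∋ : ∀ {s u v} → IsUnorderedPair M s u v → u ∈ C → v ∈ C → s ∈ D
        C∋ h i j = from (hD _) λ t k → [ (λ { refl → i }) , (λ { refl → j }) ]′ (to (h t) k)
        z⊆ : z ⊆ D
        z⊆ s k with to (p s) k | from (hC x) (inj₁ a) | from (hC y) (inj₂ b)
        ... | inj₁ u | i | j = C∋ u i i
        ... | inj₂ u | i | j = C∋ u i j

-- Natural numbers, transitive hulls, the cumulative hierarchy and collection

module Levels {ℓ : Level} (em : ExcludedMiddle ℓ) (M : Structure ℓ) (zf : ZF M) where
  open Sets em M zf public

  IsEmpty : Carrier → Set ℓ
  IsEmpty x = ∀ z → ¬ z ∈ x

  IsSuc : Carrier → Carrier → Set ℓ
  IsSuc s x = ∀ z → z ∈ s ⇔ (z ∈ x ⊎ z ≡ x)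

  Inductive : Carrier → Set ℓ
  Inductive I = (∀ e → IsEmpty e → e ∈ I) × (∀ x s → x ∈ I → IsSuc s x → s ∈ I)

  -- z is reached from x by n steps downwards along ∈, as certified by g.
  Reach : Carrier → Carrier → Carrier → Set ℓ
  Reach x n z = ∃[ g ] Pair∈ M n z g × (∀ k y → Pair∈ M k y g →
    (IsEmpty k × y ≡ x) ⊎ (∃[ j ] ∃[ u ] IsSuc k j × Pair∈ M j u g × y ∈ u))

  -- Button's definition of the levels V_α: a history is an initial segment of
  -- levels, and a level is the set of all subsets of elements of a history.
  History : Carrier → Set ℓ
  History h = ∀ x → x ∈ h → ∀ y → y ∈ x ⇔ (∃[ c ] c ∈ x × c ∈ h × y ⊆ c)

  IsLevel : Carrier → Set ℓ
  IsLevel s = ∃[ h ] History h × (∀ y → y ∈ s ⇔ (∃[ c ] c ∈ h × y ⊆ c))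

  emptyᶠ inductiveᶠ historyᶠ levelᶠ : ∀ {n} → Fin n → Fml n
  sucᶠ : ∀ {n} → Fin n → Fin n → Fml n
  reachᶠ : ∀ {n} → Fin n → Fin n → Fin n → Fml n
  emptyᶠ x = atom {P = IsEmpty} (define (∀̇ ¬̇ (v0 ∈̇ v1)) λ { (x ∷ []) → mk⇔ id id }) (x ∷ [])
  sucᶠ s x = atom {P = IsSuc} (define (∀̇ (v0 ∈̇ v1 ⇔̇ (v0 ∈̇ v2 ∨̇ v0 ≡̇ v2)))
    λ { (s ∷ x ∷ []) → mk⇔ id id }) (s ∷ x ∷ [])
  inductiveᶠ I = atom {P = Inductive} (define
    (∀̇ (emptyᶠ v0 ⇒̇ v0 ∈̇ v1) ∧̇ ∀̇ ∀̇ (v1 ∈̇ v2 ⇒̇ sucᶠ v0 v1 ⇒̇ v0 ∈̇ v2))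
    λ { (I ∷ []) → mk⇔ id id }) (I ∷ [])
  reachᶠ x n z = atom {P = Reach} (define
    (∃̇ (pair∈ᶠ v2 v3 v0 ∧̇ ∀̇ ∀̇ (pair∈ᶠ v1 v0 v2 ⇒̇
      emptyᶠ v1 ∧̇ v0 ≡̇ v3 ∨̇ ∃̇ ∃̇ (sucᶠ v3 v1 ∧̇ pair∈ᶠ v1 v0 v4 ∧̇ v2 ∈̇ v0))))
    λ { (x ∷ n ∷ z ∷ []) → mk⇔ id id }) (x ∷ n ∷ z ∷ [])
  historyᶠ h = atom {P = History} (define
    (∀̇ (v0 ∈̇ v1 ⇒̇ ∀̇ (v0 ∈̇ v1 ⇔̇ ∃̇ (v0 ∈̇ v2 ∧̇ v0 ∈̇ v3 ∧̇ v1 ⊆̇ v0))))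
    λ { (h ∷ []) → mk⇔ id id }) (h ∷ [])
  levelᶠ s = atom {P = IsLevel} (define
    (∃̇ (historyᶠ v0 ∧̇ ∀̇ (v0 ∈̇ v2 ⇔̇ ∃̇ (v0 ∈̇ v2 ∧̇ v1 ⊆̇ v0))))
    λ { (s ∷ []) → mk⇔ id id }) (s ∷ [])

  belowᶠ leastᶠ : ∀ {n} → Fml (suc (suc n)) → Fml (suc (suc n))
  belowᶠ φ = ∃̇ (v0 ∈̇ v1 ∧̇ ren (lift suc) φ)
  leastᶠ φ = levelᶠ v1 ∧̇ ren swap₀₁ φ ∧̇ ∀̇ (levelᶠ v0 ⇒̇ ren (lift (lift suc)) φ ⇒̇ ¬̇ v0 ∈̇ v2)

  suc-injective : ∀ {s x y} → IsSuc s x → IsSuc s y → x ≡ y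
  suc-injective {s} {x} {y} h k with to (k x) (from (h x) (inj₂ refl)) | to (h y) (from (k y) (inj₂ refl))
  ... | inj₂ e | _      = e
  ... | inj₁ _ | inj₂ e = sym e
  ... | inj₁ i | inj₁ j = ⊥-elim (∈-asym x y i j)

  opaque
    -- The set from `infinity` contains some empty set and some successor of each member; by
    -- extensionality it is `Inductive`, and intersecting all inductive sets inside it gives
    -- minimality.
    ω : ∃[ w ] Inductive w × (∀ I → Inductive I → w ⊆ I)
    ω =
      let w , (e , ew , ee) , sw = infinity
          u , h = sep (∀̇ (inductiveᶠ v0 ⇒̇ v1 ∈̇ v0)) [] w
          empty∈w = λ e' (ee' : IsEmpty e') →
            subst (_∈ w) (ext (λ z i → ⊥-elim (ee z i)) (λ z i → ⊥-elim (ee' z i))) ew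
          suc∈w = λ x s xw (hs : IsSuc s x) → let s' , s'w , hs' = sw x xw in
            subst (_∈ w) (ext (λ z k → from (hs z) (to (hs' z) k)) (λ z k → from (hs' z) (to (hs z) k))) s'w
      in u ,
         ((λ e' ee' → from (h e') (empty∈w e' ee' , λ I ind → proj₁ ind e' ee')) ,
          (λ x s i hs → let xw , xI = to (h x) i in
            from (h s) (suc∈w x s xw hs , λ I ind → proj₂ ind x s (xI I ind) hs))) ,
         λ I ind z i → proj₂ (to (h z) i) I ind

  opaque
    insert-pair : ∀ g a b → ∃[ g' ] (∀ x y → Pair∈ M x y g' ⇔ (Pair∈ M x y g ⊎ (x ≡ a × y ≡ b)))
    insert-pair g a b with pair-exists a b
    ... | p , hp with insert g p
    ... | g' , h = g' , λ x y → mk⇔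
      (λ (z , hz , i) → [ (λ j → inj₁ (z , hz , j)) , (λ { refl → inj₂ (pair-injective hz hp) }) ]′ (to (h z) i))
      [ (λ (z , hz , i) → z , hz , from (h z) (inj₁ i)) , (λ { (refl , refl) → p , hp , from (h p) (inj₂ refl) }) ]′

  opaque
    ∅ : ∃[ e ] IsEmpty e
    ∅ = let _ , (e , _ , h) , _ = infinity in e , h

  reach-zero : ∀ x n z → IsEmpty n → Reach x n z ⇔ z ≡ x
  reach-zero x n z en = mk⇔
    (λ (g , p , h) → [ proj₂ , (λ (j , u , s , _) → ⊥-elim (en j (from (s j) (inj₂ refl)))) ]′ (h n z p))
    λ { refl → let g , h = insert-pair (proj₁ ∅) n z in g , from (h n z) (inj₂ (refl , refl)) ,
          λ k y i → [ (λ (w , _ , j) → ⊥-elim (proj₂ ∅ w j)) , (λ { (refl , refl) → inj₁ (en , refl) }) ]′ (to (h k y) i) }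

  opaque
    -- A certificate need not be a function: each of its pairs only points to some justification one
    -- step earlier. So the same `g` certifies the predecessor, and conversely `(m , z)` can be
    -- added whatever `g` already contains.
    reach-suc : ∀ x n m z → IsSuc m n → Reach x m z ⇔ (∃[ y ] z ∈ y × Reach x n y)
    reach-suc x n m z s = mk⇔
      (λ (g , p , h) → [ (λ (em , _) → ⊥-elim (em n (from (s n) (inj₂ refl))))
                       , (λ (j , u , s' , q , i) → u , i , g , subst (λ n → Pair∈ M n u g) (suc-injective s' s) q , h) ]′ (h m z p))
      λ (y , i , g , p , h) → let g' , h' = insert-pair g m z in g' , from (h' m z) (inj₂ (refl , refl)) ,
         λ k v q → [ (λ q' → [ inj₁ , (λ (j , u , s' , r , l) → inj₂ (j , u , s' , from (h' j u) (inj₁ r) , l)) ]′ (h k v q'))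
                   , (λ { (refl , refl) → inj₂ (n , y , s , from (h' n y) (inj₁ p) , i) }) ]′ (to (h' k v) q)

  ω-induction : ∀ {n} (φ : Fml (suc n)) ρ → (∀ e → IsEmpty e → ⟦ φ ⟧ (e ∷ ρ)) →
    (∀ n m → IsSuc m n → ⟦ φ ⟧ (n ∷ ρ) → ⟦ φ ⟧ (m ∷ ρ)) →
    ∀ n → n ∈ proj₁ ω → ⟦ φ ⟧ (n ∷ ρ)
  ω-induction φ ρ base step n i = let I , hI = sep φ ρ (proj₁ ω) in
    proj₂ (to (hI n) (proj₂ (proj₂ ω) I
      ( (λ e ee → from (hI e) (proj₁ (proj₁ (proj₂ ω)) e ee , base e ee))
      , (λ m s j hs → from (hI s) (proj₂ (proj₁ (proj₂ ω)) m s (proj₁ (to (hI m) j)) hs , step m s hs (proj₂ (to (hI m) j)))))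
      n i))

  opaque
    stage : ∀ x n → n ∈ proj₁ ω → ∃[ D ] (∀ z → z ∈ D ⇔ Reach x n z)
    stage x = ω-induction (∃̇ ∀̇ (v0 ∈̇ v1 ⇔̇ reachᶠ v3 v2 v0)) (x ∷ [])
      (λ e ee → let D , hD = upair x x in D , λ z → mk⇔
        (λ j → from (reach-zero x e z ee) ([ id , id ]′ (to (hD z) j))) (λ r → from (hD z) (inj₁ (to (reach-zero x e z ee) r))))
      (λ m s hs (D , hD) → let E , hE = ⋃ D in E , λ z → mk⇔
        (λ j → let y , k , l = to (hE z) j in from (reach-suc x m s z hs) (y , k , to (hD y) l))
        (λ r → let y , k , l = to (reach-suc x m s z hs) r in from (hE z) (y , k , from (hD y) l)))

  opaque
    stages : ∀ x → ∃[ b ] (∀ n → n ∈ proj₁ ω → ∃[ D ] D ∈ b × (∀ z → z ∈ D ⇔ Reach x n z))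
    stages x = repl (∀̇ (v0 ∈̇ v2 ⇔̇ reachᶠ v3 v1 v0)) (x ∷ []) (proj₁ ω) (stage x)
      (λ n y z _ h k → ext (λ v i → from (k v) (to (h v) i)) (λ v i → from (h v) (to (k v) i)))

  opaque
    reachables : ∀ x → ∃[ T ] (∀ z → z ∈ T ⇔ (∃[ n ] n ∈ proj₁ ω × Reach x n z))
    reachables x =
      let b , hb = stages x ; U , hU = ⋃ b ; T , hT = sep (∃̇ (v0 ∈̇ v2 ∧̇ reachᶠ v3 v0 v1)) (proj₁ ω ∷ x ∷ []) U
      in T , λ z → mk⇔ (λ i → proj₂ (to (hT z) i))
        (λ (n , i , r) → let D , j , hD = hb n i in from (hT z) (from (hU z) (D , from (hD z) r , j) , n , i , r))

  opaque
    transitive-hull : ∀ x → ∃[ T ] Transitive M T × x ∈ T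
    transitive-hull x =
      let T , hT = reachables x ; w0 , ws = proj₁ (proj₂ ω) in T ,
        (λ u v i j → let n , nw , r = to (hT v) j ; s , hs = insert n n in
                     from (hT u) (s , ws n s nw hs , from (reach-suc x n s u hs) (v , i , r))) ,
        from (hT x) (proj₁ ∅ , w0 _ (proj₂ ∅) , from (reach-zero x (proj₁ ∅) x (proj₂ ∅)) refl)

  -- Foundation speaks of sets, not of classes. Inside the transitive hull of `x` the
  -- counterexamples form a set, and a minimal one has no counterexample among its members.
  ∈-induction : ∀ {n} (φ : Fml (suc n)) ρ →
    (∀ x → (∀ y → y ∈ x → ⟦ φ ⟧ (y ∷ ρ)) → ⟦ φ ⟧ (x ∷ ρ)) → ∀ x → ⟦ φ ⟧ (x ∷ ρ)
  ∈-induction φ ρ step x =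
    let T , tr , i = transitive-hull x
        B , hB = sep (¬̇ φ) ρ T in
    dne λ nx → let y , j , min = foundation B (x , from (hB x) (i , nx)) ; yT , ny = to (hB y) j in
      ny (step y λ z k → dne λ nz → min z (from (hB z) (tr z y k yT , nz)) k)

  -- If `z ∈ y ∈ x`, then `y ⊆ c` for some `c` in both `x` and `h`. By induction `c` is transitive,
  -- so `z ⊆ c` and therefore `z ∈ x`.
  history-transitive : ∀ h → History h → ∀ x → x ∈ h → Transitive M x
  history-transitive h hh = ∈-induction (v0 ∈̇ v1 ⇒̇ transitiveᶠ v0) (h ∷ [])
    λ x ih i z y zy yx → let c , cx , ch , yc = to (hh x i y) yx in
      from (hh x i z) (c , cx , ch , λ w wz → ih c cx ch w z wz (yc z zy))

  level-transitive : ∀ s → IsLevel s → Transitive M s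
  level-transitive s (h , hh , hs) z y zy ys =
    let c , ch , yc = to (hs y) ys ; d , dc , dh , zd = to (hh c ch z) (yc z zy) in from (hs z) (d , dh , zd)

  level-⊆-closed : ∀ s {x y} → IsLevel s → x ⊆ y → y ∈ s → x ∈ s
  level-⊆-closed s (h , hh , hs) xy ys = let c , ch , yc = to (hs _) ys in from (hs _) (c , ch , λ z i → yc z (xy z i))

  -- The history behind `x` is the intersection of `h` with `x`; it is one because transitivity of
  -- `x` keeps the members of members of `x` inside `x`.
  history-level : ∀ h → History h → ∀ x → x ∈ h → IsLevel x
  history-level h hh x i with sep (v0 ∈̇ v1) (x ∷ []) h
  ... | k , hk = k ,
    (λ y yk z → let yh , yx = to (hk y) yk in mk⇔
      (λ zy → let c , cy , ch , zc = to (hh y yh z) zy in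
              c , cy , from (hk c) (ch , history-transitive h hh x i c y cy yx) , zc)
      (λ (c , cy , ck , zc) → from (hh y yh z) (c , cy , proj₁ (to (hk c) ck) , zc))) ,
    λ y → mk⇔ (λ yx → let c , cx , ch , yc = to (hh x i y) yx in c , from (hk c) (ch , cx) , yc)
              (λ (c , ck , yc) → let ch , cx = to (hk c) ck in from (hh x i y) (c , cx , ch , yc))

  opaque
    level-unfold : ∀ s {x} → IsLevel s → x ∈ s → ∃[ t ] IsLevel t × t ∈ s × x ⊆ t
    level-unfold s (h , hh , hs) xs = let c , ch , xc = to (hs _) xs in
      c , history-level h hh c ch , from (hs c) (c , ch , λ _ i → i) , xc

  -- Double induction, assuming that all three alternatives fail. Each element of `s` is included in
  -- a level `s' ∈ s`, and comparing `s'` with `t` leaves only `s' ∈ t`; so `s ⊆ t`, and `t ⊆ s`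
  -- likewise.
  level-trichotomy : ∀ s → IsLevel s → ∀ t → IsLevel t → s ∈ t ⊎ s ≡ t ⊎ t ∈ s
  level-trichotomy = ∈-induction (levelᶠ v0 ⇒̇ ∀̇ (levelᶠ v0 ⇒̇ v1 ∈̇ v0 ∨̇ v1 ≡̇ v0 ∨̇ v0 ∈̇ v1)) []
    λ s ih ls → ∈-induction (levelᶠ v0 ⇒̇ v1 ∈̇ v0 ∨̇ v1 ≡̇ v0 ∨̇ v0 ∈̇ v1) (s ∷ [])
      λ t ih' lt → dne λ n → n (inj₂ (inj₁ (ext
        (λ x xs → let s' , ls' , s's , x⊆ = level-unfold s ls xs in
           level-⊆-closed t lt x⊆ ([ id , [ (λ { refl → ⊥-elim (n (inj₂ (inj₂ s's))) })
             , (λ ts' → ⊥-elim (n (inj₂ (inj₂ (level-transitive s ls t s' ts' s's))))) ]′ ]′ (ih s' s's ls' t lt)))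
        (λ x xt → let t' , lt' , t't , x⊆ = level-unfold t lt xt in
           level-⊆-closed s ls x⊆ ([ (λ st' → ⊥-elim (n (inj₁ (level-transitive t lt s t' st' t't))))
             , [ (λ { refl → ⊥-elim (n (inj₁ t't)) }) , id ]′ ]′ (ih' t' t't lt'))))))

  opaque
    pot : ∀ h → ∃[ s ] (∀ y → y ∈ s ⇔ (∃[ c ] c ∈ h × y ⊆ c))
    pot h =
      let u , hu = ⋃ h ; p , hp = ℘ u ; s , hs = sep (∃̇ (v0 ∈̇ v2 ∧̇ v1 ⊆̇ v0)) (h ∷ []) p in
      s , λ y → mk⇔ (λ i → proj₂ (to (hs y) i))
        (λ (c , ch , yc) → from (hs y) (from (hp y) (λ z zy → from (hu z) (c , yc z zy , ch)) , c , ch , yc))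

  opaque
    -- Such an `h` is itself a history, because a level consists of the subsets of its own member
    -- levels.
    downward-closed-level : ∀ h → (∀ t → t ∈ h → IsLevel t) →
      (∀ x t → x ∈ h → IsLevel t → t ∈ x → t ∈ h) → ∃[ s ] IsLevel s × h ⊆ s
    downward-closed-level h lev down =
      let s , hs = pot h in s ,
      (h , (λ x i y → mk⇔
        (λ yx → let t , lt , tx , y⊆ = level-unfold x (lev x i) yx in t , tx , down x t i lt tx , y⊆)
        (λ (c , cx , ch , yc) → level-⊆-closed x (lev x i) yc cx)) , hs) ,
      λ t i → from (hs t) (t , i , λ _ j → j)

  opaque
    level-above : ∀ H → (∀ t → t ∈ H → IsLevel t) → ∃[ s ] IsLevel s × H ⊆ s
    level-above H lH =
      let u , hu = ⋃ H
          -- One union already gives the downward closure, since levels are transitive.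
          v , hv = H ∪ u
          h , hh = sep (levelᶠ v0) [] v
          s , ls , hs = downward-closed-level h (λ t i → proj₂ (to (hh t) i))
            (λ x t i lt tx → from (hh t) (from (hv t) (inj₂
              ([ (λ xH → from (hu t) (x , tx , xH))
               , (λ xu → let y , xy , yH = to (hu x) xu in from (hu t) (y , level-transitive y (lH y yH) t x tx xy , yH)) ]′
               (to (hv x) (proj₁ (to (hh x) i))))) , lt))
      in s , ls , λ t i → hs t (from (hh t) (from (hv t) (inj₁ i) , lH t i))

  opaque
    least-level : ∀ {n} (φ : Fml (suc n)) ρ → ∃[ s ] IsLevel s × ⟦ φ ⟧ (s ∷ ρ) →
      ∃[ s ] (IsLevel s × ⟦ φ ⟧ (s ∷ ρ)) × (∀ t → IsLevel t → ⟦ φ ⟧ (t ∷ ρ) → ¬ t ∈ s)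
    least-level φ ρ (s , ls , hs) =
      -- Searching `s` together with its members suffices: every level below one of these is again a
      -- member of `s`.
      let s' , h' = insert s s
          B , hB = sep (levelᶠ v0 ∧̇ φ) ρ s'
          t , tB , min = foundation B (s , from (hB s) (from (h' s) (inj₂ refl) , ls , hs))
          ts' , lt , ht = to (hB t) tB
      in t , (lt , ht) , λ r lr hr rt →
        let rs = [ level-transitive s ls r t rt , (λ e → subst (r ∈_) e rt) ]′ (to (h' t) ts')
        in min r (from (hB r) (from (h' r) (inj₁ rs) , lr , hr)) rt

  opaque
    below⇔ : ∀ {n} (φ : Fml (suc (suc n))) {s x ρ} →
      ⟦ belowᶠ φ ⟧ (s ∷ x ∷ ρ) ⇔ (∃[ y ] y ∈ s × ⟦ φ ⟧ (y ∷ x ∷ ρ))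
    below⇔ φ {s} {x} {ρ} = mk⇔ (λ (y , i , k) → y , i , to r k) (λ (y , i , k) → y , i , from r k)
      where
      r : ∀ {y} → ⟦ ren (lift suc) φ ⟧ (y ∷ s ∷ x ∷ ρ) ⇔ ⟦ φ ⟧ (y ∷ x ∷ ρ)
      r = ⟦ren⟧ (lift suc) φ λ { zero → refl ; (suc i) → refl }

  least⇔ : ∀ {n} (φ : Fml (suc (suc n))) {x s ρ} → ⟦ leastᶠ φ ⟧ (x ∷ s ∷ ρ) ⇔
    ((IsLevel s × ⟦ φ ⟧ (s ∷ x ∷ ρ)) × (∀ t → IsLevel t → ⟦ φ ⟧ (t ∷ x ∷ ρ) → ¬ t ∈ s))
  least⇔ φ {x} {s} {ρ} = mk⇔ (λ (l , k , h) → (l , to sw k) , λ t lt kt → h t lt (from wk kt))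
                             (λ ((l , k) , h) → l , from sw k , λ t lt kt → h t lt (to wk kt))
    where
    sw : ⟦ ren swap₀₁ φ ⟧ (x ∷ s ∷ ρ) ⇔ ⟦ φ ⟧ (s ∷ x ∷ ρ)
    sw = ⟦ren⟧ swap₀₁ φ λ { zero → refl ; (suc zero) → refl ; (suc (suc i)) → refl }
    wk : ∀ {t} → ⟦ ren (lift (lift suc)) φ ⟧ (t ∷ x ∷ s ∷ ρ) ⇔ ⟦ φ ⟧ (t ∷ x ∷ ρ)
    wk = ⟦ren⟧ (lift (lift suc)) φ λ { zero → refl ; (suc zero) → refl ; (suc (suc i)) → refl }

  opaque
    -- Scott's trick: replacement wants a functional relation, and trichotomy makes the least
    -- suitable level unique.
    least-levels : ∀ {n} (φ : Fml (suc (suc n))) ρ a →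
      (∀ x → x ∈ a → ∃[ s ] IsLevel s × ⟦ φ ⟧ (s ∷ x ∷ ρ)) →
      ∃[ b ] (∀ x → x ∈ a → ∃[ s ] s ∈ b × IsLevel s × ⟦ φ ⟧ (s ∷ x ∷ ρ))
    least-levels φ ρ a ex =
      let b , hb = repl (leastᶠ φ) ρ a
            (λ x i → let s , h = least-level φ (x ∷ ρ) (ex x i) in s , from (least⇔ φ) h)
            (λ x s t _ hs ht →
              let (ls , ks) , ms = to (least⇔ φ) hs ; (lt , kt) , mt = to (least⇔ φ) ht in
              [ (λ st → ⊥-elim (mt s ls ks st))
              , [ id , (λ ts → ⊥-elim (ms t lt kt ts)) ]′ ]′ (level-trichotomy s ls t lt))
      in b , λ x i → let s , sb , h = hb x i in s , sb , proj₁ (to (least⇔ φ) h)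

  opaque
    -- Requiring the witnesses to lie in levels makes this available to `level∋`, after which
    -- `collection` can drop the requirement.
    collect-ranked : ∀ {n} (φ : Fml (suc (suc n))) ρ a →
      (∀ x → x ∈ a → ∃[ s ] IsLevel s × (∃[ y ] y ∈ s × ⟦ φ ⟧ (y ∷ x ∷ ρ))) →
      ∃[ u ] IsLevel u × (∀ x → x ∈ a → ∃[ y ] y ∈ u × ⟦ φ ⟧ (y ∷ x ∷ ρ))
    collect-ranked φ ρ a ex =
      let b , hb = least-levels (belowᶠ φ) ρ a
                     (λ x i → let s , ls , h = ex x i in s , ls , from (below⇔ φ) h)
          H , hH = sep (levelᶠ v0) [] b
          u , lu , hu = level-above H (λ t i → proj₂ (to (hH t) i))
      in u , lu , λ x i →
        let s , sb , ls , h = hb x i ; y , ys , k = to (below⇔ φ) h in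
        y , level-transitive u lu y s ys (hu s (from (hH s) (sb , ls))) , k

  opaque
    level∋level : ∀ s → IsLevel s → ∃[ t ] IsLevel t × s ∈ t
    level∋level s ls =
      let H , h = upair s s
          is-level : ∀ {t} → t ≡ s → IsLevel t
          is-level = λ e → subst IsLevel (sym e) ls
          t , lt , k = level-above H (λ t i → [ is-level , is-level ]′ (to (h t) i))
      in t , lt , k s (from (h s) (inj₁ refl))

  opaque
    level∋ : ∀ x → ∃[ s ] IsLevel s × x ∈ s
    level∋ = ∈-induction (∃̇ (levelᶠ v0 ∧̇ v1 ∈̇ v0)) [] λ x ih →
      -- What is collected for `y ∈ x` is a level containing `y`, itself placed in a further level.
      -- As `u` is transitive, `x ⊆ u`, and any level above `u` contains `x`.
      let u , lu , h = collect-ranked (levelᶠ v0 ∧̇ v1 ∈̇ v0) [] x λ y i →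
                         let s , ls , ys = ih y i ; t , lt , st = level∋level s ls in t , lt , s , st , ls , ys
          v , lv , uv = level∋level u lu
      in v , lv , level-⊆-closed v lv (λ y yx → let s , su , ls , ys = h y yx in level-transitive u lu y s ys su) uv

  opaque
    collection : ∀ {n} (φ : Fml (suc (suc n))) ρ a →
      (∀ x → x ∈ a → ∃[ y ] ⟦ φ ⟧ (y ∷ x ∷ ρ)) →
      ∃[ u ] IsLevel u × (∀ x → x ∈ a → ∃[ y ] y ∈ u × ⟦ φ ⟧ (y ∷ x ∷ ρ))
    collection φ ρ a ex = collect-ranked φ ρ a λ x i →
      let y , k = ex x i ; s , ls , ys = level∋ y in s , ls , y , ys , k

  level-max : ∀ s t → IsLevel s → IsLevel t → s ⊆ t ⊎ t ⊆ s
  level-max s t ls lt = [ (λ i → inj₁ λ x j → level-transitive t lt x s j i)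
    , [ (λ { refl → inj₁ λ _ j → j }) , (λ i → inj₂ λ x j → level-transitive s ls x t j i) ]′ ]′ (level-trichotomy s ls t lt)

  opaque
    common-level : ∀ x y → ∃[ s ] IsLevel s × x ∈ s × y ∈ s
    common-level x y =
      let s , ls , xs = level∋ x ; t , lt , yt = level∋ y in
      [ (λ st → t , lt , st x xs , yt) , (λ ts → s , ls , xs , ts y yt) ]′ (level-max s t ls lt)

  opaque
    common-lower-level : ∀ s {x y} → IsLevel s → x ∈ s → y ∈ s → ∃[ t ] IsLevel t × t ∈ s × x ⊆ t × y ⊆ t
    common-lower-level s ls xs ys =
      let t , lt , ts , xt = level-unfold s ls xs ; r , lr , rs , yr = level-unfold s ls ys in
      [ (λ tr → r , lr , rs , (λ z i → tr z (xt z i)) , yr)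
      , (λ rt → t , lt , ts , xt , (λ z i → rt z (yr z i))) ]′ (level-max t r lt lr)

  level-induction : ∀ {n} (φ : Fml (suc n)) ρ →
    (∀ s → IsLevel s → (∀ t → IsLevel t → t ∈ s → ⟦ φ ⟧ (t ∷ ρ)) → ⟦ φ ⟧ (s ∷ ρ)) →
    ∀ s → IsLevel s → ⟦ φ ⟧ (s ∷ ρ)
  level-induction φ ρ step = ∈-induction (levelᶠ v0 ⇒̇ φ) ρ λ s ih ls → step s ls λ t lt ts → ih t ts lt

pattern ↑1 i = suc i
pattern ↑2 i = suc (↑1 i)
pattern ↑3 i = suc (↑2 i)
pattern ↑4 i = suc (↑3 i)

-- Definability and basic laws of the forcing relation, and the recursion for names

module ForcingTheory {ℓ : Level} (em : ExcludedMiddle ℓ) (M : Structure ℓ) (zf : ZF M) where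
  open Levels em M zf public

  module F = Forcing M

  domᶠ : ∀ {n} → Fin n → Fin n → Fml n
  domᶠ τ ϑ = ∃̇ pair∈ᶠ v0 (↑1 ϑ) (↑1 τ)

  memClauseᶠ : ∀ {n} → (Fin (4 + n) → Fin (4 + n) → Fin (4 + n) → Fml (4 + n)) →
               Fin n → Fin n → Fin n → Fin n → Fml n
  memClauseᶠ Eq R p π τ = ∀̇ (pair∈ᶠ v0 (↑1 p) (↑1 R) ⇒̇
    ∃̇ (pair∈ᶠ v0 v1 (↑2 R) ∧̇
    ∃̇ ∃̇ (pair∈ᶠ v1 v0 (↑4 τ) ∧̇ pair∈ᶠ v2 v1 (↑4 R) ∧̇ Eq v2 (↑4 π) v0)))

  eqClauseᶠ : ∀ {n} → (Fin (2 + n) → Fin (2 + n) → Fin (2 + n) → Fml (2 + n)) →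
              Fin n → Fin n → Fin n → Fin n → Fml n
  eqClauseᶠ Mem R p σ τ = ∀̇ (domᶠ (↑1 σ) v0 ∨̇ domᶠ (↑1 τ) v0 ⇒̇
    ∀̇ (pair∈ᶠ v0 (↑2 p) (↑2 R) ⇒̇ (Mem v0 v1 (↑2 σ) ⇔̇ Mem v0 v1 (↑2 τ))))

  eqRecursionᶠ nameRecursionᶠ : ∀ {n} → Fin n → Fin n → Fin n → Fin n → Fml n
  nameRecursionᶠ P R T N = atom {P = F.NameRecursion} (define
    (∀̇ (v0 ∈̇ v3 ⇒̇ (v0 ∈̇ v4 ⇔̇ ∀̇ (v0 ∈̇ v1 ⇒̇ ∃̇ ∃̇ (v1 ∈̇ v4 ∧̇ v0 ∈̇ v7 ∧̇ pairᶠ v2 v1 v0)))))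
    λ { (P ∷ R ∷ T ∷ N ∷ []) → mk⇔ id id }) (P ∷ R ∷ T ∷ N ∷ [])
  eqRecursionᶠ P R T E = atom {P = F.EqRecursion} (define
    (∀̇ ∀̇ ∀̇ (v2 ∈̇ v3 ⇒̇ v1 ∈̇ v5 ⇒̇ v0 ∈̇ v5 ⇒̇
      (triple∈ᶠ v2 v1 v0 v6 ⇔̇
       eqClauseᶠ (memClauseᶠ (λ q x y → triple∈ᶠ q x y (↑4 (↑4 (↑4 v0)))) v6) v4 v2 v1 v0)))
    λ { (P ∷ R ∷ T ∷ E ∷ []) → mk⇔ id id }) (P ∷ R ∷ T ∷ E ∷ [])

  forcesEqᶠ forcesMemᶠ : ∀ {n} → Fin n → Fin n → Fin n → Fin n → Fin n → Fml n
  forcesEqᶠ P R p σ τ = atom {P = F.ForcesEq} (define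
    (∃̇ ∃̇ (transitiveᶠ v1 ∧̇ eqRecursionᶠ v2 v3 v1 v0 ∧̇ v5 ∈̇ v1 ∧̇ v6 ∈̇ v1 ∧̇ triple∈ᶠ v4 v5 v6 v0))
    λ { (P ∷ R ∷ p ∷ σ ∷ τ ∷ []) → mk⇔ id id }) (P ∷ R ∷ p ∷ σ ∷ τ ∷ [])
  forcesMemᶠ P R p σ τ = atom {P = F.ForcesMem} (define (memClauseᶠ (forcesEqᶠ v4 v5) v1 v2 v3 v4)
    λ { (P ∷ R ∷ p ∷ σ ∷ τ ∷ []) → mk⇔ id id }) (P ∷ R ∷ p ∷ σ ∷ τ ∷ [])

  isNameᶠ : ∀ {n} → Fin n → Fin n → Fin n → Fml n
  isNameᶠ P R x = atom {P = F.IsName} (define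
    (∃̇ ∃̇ (transitiveᶠ v1 ∧̇ nameRecursionᶠ v2 v3 v1 v0 ∧̇ v4 ∈̇ v1 ∧̇ v4 ∈̇ v0))
    λ { (P ∷ R ∷ x ∷ []) → mk⇔ id id }) (P ∷ R ∷ x ∷ [])

  -- The map `e` locates the variables of the forced formula among those of the result; it is
  -- carried along because quantified conditions come to stand between the names.
  forcesᶠ : ∀ {m n} → Formula m → (P R p : Fin n) → (Fin m → Fin n) → Fml n
  forcesᶠ (i `∈ j) P R p e = forcesMemᶠ P R p (e i) (e j)
  forcesᶠ (i `≡ j) P R p e = forcesEqᶠ P R p (e i) (e j)
  forcesᶠ (`¬ φ)   P R p e = ∀̇ (pair∈ᶠ v0 (↑1 p) (↑1 R) ⇒̇ ¬̇ forcesᶠ φ (↑1 P) (↑1 R) v0 (suc ∘ e))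
  forcesᶠ (φ `∧ ψ) P R p e = forcesᶠ φ P R p e ∧̇ forcesᶠ ψ P R p e
  forcesᶠ (`∃ φ)   P R p e = ∀̇ (pair∈ᶠ v0 (↑1 p) (↑1 R) ⇒̇
    ∃̇ (pair∈ᶠ v0 v1 (↑2 R) ∧̇
    ∃̇ (isNameᶠ (↑3 P) (↑3 R) v0 ∧̇ forcesᶠ φ (↑3 P) (↑3 R) v1 (lift (λ i → ↑2 (e i))))))

  ⟦pair∈⟧ : ∀ {n} (x y r : Fin n) σ → ⟦ pair∈ᶠ x y r ⟧ σ ⇔ Pair∈ M (lookup σ x) (lookup σ y) (lookup σ r)
  ⟦pair∈⟧ x y r σ = ≡⇒⇔ (at≡ (Pair∈ M) (x ∷ y ∷ r ∷ []) σ)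

  ⟦forces⟧ : ∀ {m n} (φ : Formula m) (P R p : Fin n) e {σ ρ} → (∀ i → lookup σ (e i) ≡ lookup ρ i) →
    ⟦ forcesᶠ φ P R p e ⟧ σ ⇔ F.Forces (lookup σ P) (lookup σ R) (lookup σ p) φ ρ
  ⟦forces⟧ (i `∈ j) P R p e {σ} h = ≡⇒⇔ (trans (at≡ F.ForcesMem (P ∷ R ∷ p ∷ e i ∷ e j ∷ []) σ)
    (cong₂ (F.ForcesMem (lookup σ P) (lookup σ R) (lookup σ p)) (h i) (h j)))
  ⟦forces⟧ (i `≡ j) P R p e {σ} h = ≡⇒⇔ (trans (at≡ F.ForcesEq (P ∷ R ∷ p ∷ e i ∷ e j ∷ []) σ)
    (cong₂ (F.ForcesEq (lookup σ P) (lookup σ R) (lookup σ p)) (h i) (h j)))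
  ⟦forces⟧ (`¬ φ) P R p e {σ} {ρ} h = mk⇔
    (λ k q l f → k q (from (le q) l) (from (rec q) f)) (λ k q l f → k q (to (le q) l) (to (rec q) f))
    where
    le : ∀ q → ⟦ pair∈ᶠ v0 (↑1 p) (↑1 R) ⟧ (q ∷ σ) ⇔ Pair∈ M q (lookup σ p) (lookup σ R)
    le q = ⟦pair∈⟧ v0 (↑1 p) (↑1 R) (q ∷ σ)
    rec : ∀ q → ⟦ forcesᶠ φ (↑1 P) (↑1 R) v0 (suc ∘ e) ⟧ (q ∷ σ) ⇔ F.Forces (lookup σ P) (lookup σ R) q φ ρ
    rec q = ⟦forces⟧ φ (↑1 P) (↑1 R) v0 (suc ∘ e) {q ∷ σ} h
  ⟦forces⟧ (φ `∧ ψ) P R p e h = let a = ⟦forces⟧ φ P R p e h ; b = ⟦forces⟧ ψ P R p e h in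
    mk⇔ (λ (x , y) → to a x , to b y) (λ (x , y) → from a x , from b y)
  ⟦forces⟧ (`∃ φ) P R p e {σ} {ρ} h = mk⇔ fwd bwd
    where
    le : ∀ q → ⟦ pair∈ᶠ v0 (↑1 p) (↑1 R) ⟧ (q ∷ σ) ⇔ Pair∈ M q (lookup σ p) (lookup σ R)
    le q = ⟦pair∈⟧ v0 (↑1 p) (↑1 R) (q ∷ σ)
    le' : ∀ q r → ⟦ pair∈ᶠ v0 v1 (↑2 R) ⟧ (r ∷ q ∷ σ) ⇔ Pair∈ M r q (lookup σ R)
    le' q r = ⟦pair∈⟧ v0 v1 (↑2 R) (r ∷ q ∷ σ)
    nm : ∀ q r τ → ⟦ isNameᶠ (↑3 P) (↑3 R) v0 ⟧ (τ ∷ r ∷ q ∷ σ) ⇔ F.IsName (lookup σ P) (lookup σ R) τ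
    nm q r τ = ≡⇒⇔ (at≡ F.IsName (↑3 P ∷ ↑3 R ∷ v0 ∷ []) (τ ∷ r ∷ q ∷ σ))
    rec : ∀ q r τ → ⟦ forcesᶠ φ (↑3 P) (↑3 R) v1 (lift (λ i → ↑2 (e i))) ⟧ (τ ∷ r ∷ q ∷ σ) ⇔
          F.Forces (lookup σ P) (lookup σ R) r φ (τ ∷ ρ)
    rec q r τ = ⟦forces⟧ φ (↑3 P) (↑3 R) v1 (lift (λ i → ↑2 (e i))) {τ ∷ r ∷ q ∷ σ} λ { zero → refl ; (suc i) → h i }
    fwd : ⟦ forcesᶠ (`∃ φ) P R p e ⟧ σ → F.Forces (lookup σ P) (lookup σ R) (lookup σ p) (`∃ φ) ρ
    fwd k q l = let r , l' , τ , n , f = k q (from (le q) l) in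
      r , to (le' q r) l' , τ , to (nm q r τ) n , to (rec q r τ) f
    bwd : F.Forces (lookup σ P) (lookup σ R) (lookup σ p) (`∃ φ) ρ → ⟦ forcesᶠ (`∃ φ) P R p e ⟧ σ
    bwd k q l = let r , l' , τ , n , f = k q (to (le q) l) in
      r , from (le' q r) l' , τ , from (nm q r τ) n , from (rec q r τ) f

  module Order (P R : Carrier) (po : IsPartialOrder M P R) where
    open Forcing M P R public
    module PO = IsPartialOrder po

    tripleᵣ : ∀ {n} → Fin (3 + n) → Fin (4 + n)
    tripleᵣ v0 = v2
    tripleᵣ v1 = v0
    tripleᵣ v2 = v1
    tripleᵣ (↑3 i) = ↑4 i

    EqC : (Carrier → Carrier → Carrier → Set ℓ) → Carrier → Carrier → Carrier → Set ℓ
    EqC Eq = EqClause (MemClause Eq)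

    InE : Carrier → Carrier → Carrier → Carrier → Set ℓ
    InE E q x y = Triple∈ M q x y E

    ⊴-refl : ∀ p → p ∈ P → p ⊴ p
    ⊴-refl = PO.reflexive

    ⊴-trans : ∀ p q r → p ⊴ q → q ⊴ r → p ⊴ r
    ⊴-trans = PO.transitive

    ⊴-dom : ∀ {p q} → p ⊴ q → p ∈ P × q ∈ P
    ⊴-dom (z , h , i) = let p , q , pP , qP , k = PO.relation z i ; e , e' = pair-injective h k in
      subst (_∈ P) (sym e) pP , subst (_∈ P) (sym e') qP

    dom-⊆ : ∀ {T τ ϑ} → Transitive M T → τ ⊆ T → Dom τ ϑ → ϑ ∈ T
    dom-⊆ tr sub (s , z , h , i) = proj₂ (pair-transitive tr h (sub z i))

    dom-∈ : ∀ {T τ ϑ} → Transitive M T → τ ∈ T → Dom τ ϑ → ϑ ∈ T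
    dom-∈ tr i = dom-⊆ tr λ z j → tr z _ j i

    MemClause-map : ∀ {Eq₁ Eq₂ : Carrier → Carrier → Carrier → Set ℓ} (D : Carrier → Set ℓ) →
      (∀ r a b → r ∈ P → D a → D b → Eq₁ r a b → Eq₂ r a b) →
      ∀ {q ϑ τ} → D ϑ → (∀ {σ} → Dom τ σ → D σ) → MemClause Eq₁ q ϑ τ → MemClause Eq₂ q ϑ τ
    MemClause-map D f d dτ h q' l = let r , rq , s , σ , i , rs , e = h q' l in
      r , rq , s , σ , i , rs , f r _ σ (proj₁ (⊴-dom rq)) d (dτ (s , i)) e

    -- The clause for `a` and `b` consults the relation only at pairs of names from the domains of
    -- `a` and `b`, so agreement on a class containing these domains is enough.
    EqClause-cong : ∀ {Eq₁ Eq₂ : Carrier → Carrier → Carrier → Set ℓ} (D : Carrier → Set ℓ) →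
      (∀ r a b → r ∈ P → D a → D b → Eq₁ r a b ⇔ Eq₂ r a b) →
      ∀ {p a b} → (∀ {σ} → Dom a σ → D σ) → (∀ {σ} → Dom b σ → D σ) →
      EqC Eq₁ p a b ⇔ EqC Eq₂ p a b
    EqClause-cong {Eq₁} {Eq₂} D f {p} {a} {b} da db = mk⇔
      (λ h ϑ k q l → let d = [ da , db ]′ k in mk⇔
         (λ m → f⁺ d db (to (h ϑ k q l) (f⁻ d da m))) (λ m → f⁺ d da (from (h ϑ k q l) (f⁻ d db m))))
      (λ h ϑ k q l → let d = [ da , db ]′ k in mk⇔
         (λ m → f⁻ d db (to (h ϑ k q l) (f⁺ d da m))) (λ m → f⁻ d da (from (h ϑ k q l) (f⁺ d db m))))
      where
      f⁺ : ∀ {q ϑ τ} → D ϑ → (∀ {σ} → Dom τ σ → D σ) → MemClause Eq₁ q ϑ τ → MemClause Eq₂ q ϑ τ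
      f⁺ = MemClause-map {Eq₁} {Eq₂} D λ r a b i j k → to (f r a b i j k)
      f⁻ : ∀ {q ϑ τ} → D ϑ → (∀ {σ} → Dom τ σ → D σ) → MemClause Eq₂ q ϑ τ → MemClause Eq₁ q ϑ τ
      f⁻ = MemClause-map {Eq₂} {Eq₁} D λ r a b i j k → from (f r a b i j k)

    -- Induction on levels replaces a rank on pairs: if a , b ∈ s then a , b ⊆ t for
    -- a single level t ∈ s, and the clause for (a , b) only refers to pairs from t.
    recursion-agrees : ∀ T E T' E' → Transitive M T → EqRecursion T E → Transitive M T' → EqRecursion T' E' →
      ∀ s → IsLevel s → ∀ a b p → a ∈ s → b ∈ s → a ∈ T → b ∈ T → a ∈ T' → b ∈ T' → p ∈ P →
      Triple∈ M p a b E ⇔ Triple∈ M p a b E'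
    recursion-agrees T E T' E' tr rec tr' rec' = level-induction
      (∀̇ ∀̇ ∀̇ (v2 ∈̇ v3 ⇒̇ v1 ∈̇ v3 ⇒̇ v2 ∈̇ v4 ⇒̇ v1 ∈̇ v4 ⇒̇ v2 ∈̇ v6 ⇒̇ v1 ∈̇ v6 ⇒̇ v0 ∈̇ v8 ⇒̇
        (triple∈ᶠ v0 v2 v1 v5 ⇔̇ triple∈ᶠ v0 v2 v1 v7)))
      (T ∷ E ∷ T' ∷ E' ∷ P ∷ [])
      λ s ls ih a b p as bs aT bT aT' bT' pP →
        let t , lt , ts , at , bt = common-lower-level s ls as bs
            below : ∀ {x} → x ⊆ t → x ∈ T → x ∈ T' → ∀ {σ} → Dom x σ → σ ∈ t × σ ∈ T × σ ∈ T'
            below = λ xt xT xT' d → dom-⊆ (level-transitive t lt) xt d , dom-∈ tr xT d , dom-∈ tr' xT' d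
            c : EqC (InE E) p a b ⇔ EqC (InE E') p a b
            c = EqClause-cong (λ x → x ∈ t × x ∈ T × x ∈ T')
                  (λ r x y rP (xt , xT , xT') (yt , yT , yT') → ih t lt ts x y r xt yt xT yT xT' yT' rP)
                  (below at aT aT') (below bt bT bT')
            h = rec p a b pP aT bT
            h' = rec' p a b pP aT' bT'
        in mk⇔ (λ x → from h' (to c (to h x))) (λ x → from h (from c (to h' x)))

    forcesEq-solution : ∀ {T E p a b} → Transitive M T → EqRecursion T E → p ∈ P → a ∈ T → b ∈ T →
      ForcesEq p a b ⇔ Triple∈ M p a b E
    forcesEq-solution {T} {E} {p} {a} {b} tr rec pP aT bT = mk⇔
      (λ (T' , E' , tr' , rec' , aT' , bT' , h) → let s , ls , as , bs = common-level a b in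
        to (recursion-agrees T' E' T E tr' rec' tr rec s ls a b p as bs aT' bT' aT bT pP) h)
      (λ h → T , E , tr , rec , aT , bT , h)

    opaque
      triple-relation : ∀ {n} (φ : Fml (3 + n)) ρ A B →
        ∃[ E ] (∀ p a b → Triple∈ M p a b E ⇔ (p ∈ A × a ∈ B × b ∈ B × ⟦ φ ⟧ (p ∷ a ∷ b ∷ ρ)))
      triple-relation {n} φ ρ A B =
        let C , _ , hC = relation (v0 ≡̇ v0) [] B B
            E , _ , hE = relation (∃̇ ∃̇ (pairᶠ v3 v0 v1 ∧̇ ren tripleᵣ φ)) ρ A C in
        E , λ p a b →
          let r : ∀ {w} → ⟦ ren tripleᵣ φ ⟧ (a ∷ b ∷ p ∷ w ∷ ρ) ⇔ ⟦ φ ⟧ (p ∷ a ∷ b ∷ ρ)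
              r = ⟦ren⟧ tripleᵣ φ λ { v0 → refl ; v1 → refl ; v2 → refl ; (↑3 i) → refl }
          in mk⇔
            (λ (w , hw , k) → let pA , wC , b' , a' , hw' , q = to (hE p w) k
                                  aB , bB , _ = to (hC a b) (w , hw , wC)
                                  e , e' = pair-injective hw' hw in
              pA , aB , bB , to r (subst₂' e e' q))
            (λ (pA , aB , bB , q) → let w , hw , wC = from (hC a b) (aB , bB , refl) in
              w , hw , from (hE p w) (pA , wC , b , a , hw , from r q))
        where
        subst₂' : ∀ {a a' b b' p w} → a' ≡ a → b' ≡ b →
          ⟦ ren tripleᵣ φ ⟧ (a' ∷ b' ∷ p ∷ w ∷ ρ) → ⟦ ren tripleᵣ φ ⟧ (a ∷ b ∷ p ∷ w ∷ ρ)
        subst₂' refl refl q = q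

    opaque
      forced-equalities : ∀ s → ∃[ E ] (∀ p a b → Triple∈ M p a b E ⇔
        (p ∈ P × a ∈ s × b ∈ s × EqC ForcesEq p a b))
      forced-equalities s = triple-relation
        (eqClauseᶠ (forcesMemᶠ v5 v6) v4 v0 v1 v2) (P ∷ R ∷ []) P s

    opaque
      -- The solution on `s` is defined outright by the clause over `ForcesEq`, without gluing
      -- smaller solutions. These only show that `ForcesEq` and `E` agree on a level `t ∈ s` holding
      -- all names that the clause for `a` and `b` consults.
      recursion-solvable : ∀ s → IsLevel s → ∃[ E ] EqRecursion s E
      recursion-solvable = level-induction (∃̇ eqRecursionᶠ v2 v3 v1 v0) (P ∷ R ∷ []) λ s ls ih →
        let E , hE = forced-equalities s in E , λ p a b pP as bs →
          let t , lt , ts , at , bt = common-lower-level s ls as bs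
              F , recF = ih t lt ts
              trt = level-transitive t lt
              s∋ : ∀ {x} → x ∈ t → x ∈ s
              s∋ = λ xt → level-transitive s ls _ t xt ts
              eq : ∀ r c d → r ∈ P → c ∈ t → d ∈ t → ForcesEq r c d ⇔ Triple∈ M r c d F
              eq = λ r c d rP ct dt → forcesEq-solution trt recF rP ct dt
              agree : ∀ r c d → r ∈ P → c ∈ t → d ∈ t → ForcesEq r c d ⇔ Triple∈ M r c d E
              agree = λ r c d rP ct dt →
                let k : EqC ForcesEq r c d ⇔ EqC (InE F) r c d
                    k = EqClause-cong (_∈ t) eq (dom-∈ trt ct) (dom-∈ trt dt)
                    f = recF r c d rP ct dt
                in mk⇔ (λ x → from (hE r c d) (rP , s∋ ct , s∋ dt , from k (to f (to (eq r c d rP ct dt) x))))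
                       (λ x → from (eq r c d rP ct dt) (from f (to k (proj₂ (proj₂ (proj₂ (to (hE r c d) x)))))))
              k : EqC ForcesEq p a b ⇔ EqC (InE E) p a b
              k = EqClause-cong (_∈ t) agree (dom-⊆ trt at) (dom-⊆ trt bt)
          in mk⇔ (λ x → to k (proj₂ (proj₂ (proj₂ (to (hE p a b) x)))))
                 (λ x → from (hE p a b) (pP , as , bs , from k x))

    -- Frees the recursion equation from the auxiliary `T` and `E`: on a level containing both names
    -- a solution exists, and it computes `ForcesEq`.
    forcesEq-unfold : ∀ p a b → p ∈ P → ForcesEq p a b ⇔ EqClause ForcesMem p a b
    forcesEq-unfold p a b pP =
      let s , ls , as , bs = common-level a b
          tr = level-transitive s ls
          E , rec = recursion-solvable s ls
          k : EqC ForcesEq p a b ⇔ EqC (InE E) p a b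
          k = EqClause-cong (_∈ s) (λ r c d rP cs ds → forcesEq-solution tr rec rP cs ds) (dom-∈ tr as) (dom-∈ tr bs)
          h = forcesEq-solution tr rec pP as bs
          h' = rec p a b pP as bs
      in mk⇔ (λ x → from k (to h' (to h x))) (λ x → from h (from h' (to k x)))

    forcesMem-mono : ∀ p q π τ → q ⊴ p → ForcesMem p π τ → ForcesMem q π τ
    forcesMem-mono p q π τ l h r k = h r (⊴-trans r q p k l)

    forcesEq-mono : ∀ p q σ τ → q ⊴ p → ForcesEq p σ τ → ForcesEq q σ τ
    forcesEq-mono p q σ τ l h = from (forcesEq-unfold q σ τ (proj₁ (⊴-dom l))) λ ϑ d r k →
      to (forcesEq-unfold p σ τ (proj₂ (⊴-dom l))) h ϑ d r (⊴-trans r q p k l)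

    forcesEq-refl : ∀ p σ → p ∈ P → ForcesEq p σ σ
    forcesEq-refl p σ pP = from (forcesEq-unfold p σ σ pP) λ _ _ _ _ → ⇔-id _

    forcesEq-sym : ∀ p σ τ → p ∈ P → ForcesEq p σ τ → ForcesEq p τ σ
    forcesEq-sym p σ τ pP h = from (forcesEq-unfold p τ σ pP) λ ϑ d q l →
      ⇔-sym (to (forcesEq-unfold p σ τ pP) h ϑ ([ inj₂ , inj₁ ]′ d) q l)

    forcesMem-pair : ∀ p s ϑ σ → Pair∈ M s ϑ σ → p ⊴ s → ForcesMem p ϑ σ
    forcesMem-pair p s ϑ σ i l q k =
      q , ⊴-refl q (proj₁ (⊴-dom k)) , s , ϑ , i , ⊴-trans q p s k l , forcesEq-refl q ϑ (proj₁ (⊴-dom k))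

    EqTransitiveOn : (Carrier → Set ℓ) → Set ℓ
    EqTransitiveOn D = ∀ p a b c → p ∈ P → D a → D b → D c → ForcesEq p a b → ForcesEq p b c → ForcesEq p a c

    -- Transitivity is assumed only on a class containing `χ` and the domains, which is what an
    -- induction can supply while `α` and `β` lie one step higher.
    forcesMem-transport : ∀ D → EqTransitiveOn D → ∀ p χ α β → p ∈ P → D χ →
      (∀ {ξ} → Dom α ξ → D ξ) → (∀ {ξ} → Dom β ξ → D ξ) →
      ForcesEq p α β → ForcesMem p χ α → ForcesMem p χ β
    forcesMem-transport D tr p χ α β pP dχ dα dβ e h q l =
      let r , rq , s , ξ , i , rs , eχξ = h q l
          rP , qP = ⊴-dom rq
          r' , r'r , s' , ζ , i' , r's' , eξζ =
            to (to (forcesEq-unfold p α β pP) e ξ (inj₁ (s , i)) r (⊴-trans r q p rq l))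
               (forcesMem-pair r s ξ α i rs) r (⊴-refl r rP)
      in r' , ⊴-trans r' r q r'r rq , s' , ζ , i' , r's' ,
         tr r' χ ξ ζ (proj₁ (⊴-dom r'r)) dχ (dα (s , i)) (dβ (s' , i')) (forcesEq-mono r r' χ ξ r'r eχξ) eξζ

    forcesEq-trans-step : ∀ D → EqTransitiveOn D → ∀ p a b c → p ∈ P →
      (∀ {ξ} → Dom a ξ → D ξ) → (∀ {ξ} → Dom b ξ → D ξ) → (∀ {ξ} → Dom c ξ → D ξ) →
      ForcesEq p a b → ForcesEq p b c → ForcesEq p a c
    forcesEq-trans-step D tr p a b c pP da db dc ab bc = from (forcesEq-unfold p a c pP) λ χ d q l →
      let qP = proj₁ (⊴-dom l)
          dχ = [ da , dc ]′ d
          ab' = forcesEq-mono p q a b l ab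
          bc' = forcesEq-mono p q b c l bc
      in mk⇔
        (λ h → forcesMem-transport D tr q χ b c qP dχ db dc bc'
                 (forcesMem-transport D tr q χ a b qP dχ da db ab' h))
        (λ h → forcesMem-transport D tr q χ b a qP dχ db da (forcesEq-sym q a b qP ab')
                 (forcesMem-transport D tr q χ c b qP dχ dc db (forcesEq-sym q b c qP bc') h))

    forcesEq-trans-level : ∀ s → IsLevel s → EqTransitiveOn (_∈ s)
    forcesEq-trans-level = level-induction
      (∀̇ ∀̇ ∀̇ ∀̇ (v3 ∈̇ v5 ⇒̇ v2 ∈̇ v4 ⇒̇ v1 ∈̇ v4 ⇒̇ v0 ∈̇ v4 ⇒̇
        forcesEqᶠ v5 v6 v3 v2 v1 ⇒̇ forcesEqᶠ v5 v6 v3 v1 v0 ⇒̇ forcesEqᶠ v5 v6 v3 v2 v0))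
      (P ∷ R ∷ [])
      λ s ls ih p a b c pP as bs cs ab bc →
        -- Three names must fit into one level below `s`: the larger of a level for `a` and `b` and
        -- a level for `c`.
        let t , lt , ts , at , bt = common-lower-level s ls as bs
            r , lr , rs , ct = level-unfold s ls cs
            step : ∀ u → IsLevel u → u ∈ s → a ⊆ u → b ⊆ u → c ⊆ u → ForcesEq p a c
            step = λ u lu us au bu cu → let tru = level-transitive u lu in
              forcesEq-trans-step (_∈ u) (ih u lu us) p a b c pP (dom-⊆ tru au) (dom-⊆ tru bu) (dom-⊆ tru cu) ab bc
        in [ (λ tr → step r lr rs (λ z i → tr z (at z i)) (λ z i → tr z (bt z i)) ct)
           , (λ rt → step t lt ts at bt (λ z i → rt z (ct z i))) ]′ (level-max t r lt lr)

    forcesEq-trans : ∀ p a b c → p ∈ P → ForcesEq p a b → ForcesEq p b c → ForcesEq p a c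
    forcesEq-trans p a b c pP =
      let s , ls , as , bs = common-level a b
          t , lt , st , ct = common-level s c
          trt = level-transitive t lt
      in forcesEq-trans-level t lt p a b c pP (trt a s as st) (trt b s bs st) ct

    forcesMem-substʳ : ∀ p π σ τ → p ∈ P → ForcesEq p σ τ → ForcesMem p π σ → ForcesMem p π τ
    -- `x ≡ x` is the class of all sets, on which transitivity is now known.
    forcesMem-substʳ p π σ τ pP = forcesMem-transport (λ x → x ≡ x)
      (λ p a b c pP _ _ _ → forcesEq-trans p a b c pP) p π σ τ pP refl (λ _ → refl) (λ _ → refl)

    forcesMem-substˡ : ∀ p π σ τ → p ∈ P → ForcesEq p π σ → ForcesMem p π τ → ForcesMem p σ τ
    forcesMem-substˡ p π σ τ pP e h q l =
      let r , rq , s , ξ , i , rs , f = h q l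
          rP = proj₁ (⊴-dom rq)
      in r , rq , s , ξ , i , rs , forcesEq-trans r σ π ξ rP
           (forcesEq-sym r π σ rP (forcesEq-mono p r π σ (⊴-trans r q p rq l) e)) f

    forces-mono : ∀ {n} (φ : Formula n) ρ p q → q ⊴ p → Forces p φ ρ → Forces q φ ρ
    forces-mono (i `∈ j) ρ p q l h = forcesMem-mono p q (lookup ρ i) (lookup ρ j) l h
    forces-mono (i `≡ j) ρ p q l h = forcesEq-mono p q (lookup ρ i) (lookup ρ j) l h
    forces-mono (`¬ φ) ρ p q l h r k = h r (⊴-trans r q p k l)
    forces-mono (φ `∧ ψ) ρ p q l (h , k) = forces-mono φ ρ p q l h , forces-mono ψ ρ p q l k
    forces-mono (`∃ φ) ρ p q l h r k = h r (⊴-trans r q p k l)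

    Dense : Carrier → (Carrier → Set ℓ) → Set ℓ
    Dense p D = ∀ q → q ⊴ p → ∃[ r ] r ⊴ q × D r

    forcesMem-dense : ∀ p π τ → Dense p (λ r → ForcesMem r π τ) → ForcesMem p π τ
    forcesMem-dense p π τ h q l =
      let r , rq , k = h q l
          r' , r'r , m = k r (⊴-refl r (proj₁ (⊴-dom rq)))
      in r' , ⊴-trans r' r q r'r rq , m

    forcesEq-dense : ∀ p σ τ → p ∈ P → Dense p (λ r → ForcesEq r σ τ) → ForcesEq p σ τ
    forcesEq-dense p σ τ pP h = from (forcesEq-unfold p σ τ pP) λ ϑ d q l → mk⇔
      (λ m → forcesMem-dense q ϑ τ λ q' l' → let r , rq , e = h q' (⊴-trans q' q p l' l) ; rP = proj₁ (⊴-dom rq) in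
        r , rq , forcesMem-substʳ r ϑ σ τ rP e (forcesMem-mono q r ϑ σ (⊴-trans r q' q rq l') m))
      (λ m → forcesMem-dense q ϑ σ λ q' l' → let r , rq , e = h q' (⊴-trans q' q p l' l) ; rP = proj₁ (⊴-dom rq) in
        r , rq , forcesMem-substʳ r ϑ τ σ rP (forcesEq-sym r σ τ rP e) (forcesMem-mono q r ϑ τ (⊴-trans r q' q rq l') m))

    -- The mixed name is controlled only on a dense set of conditions, whence the need for this.
    -- Membership and existence already ask for density and absorb a second instance of it; negation
    -- is refuted at a common extension.
    forces-dense : ∀ {n} (φ : Formula n) ρ p → p ∈ P → Dense p (λ r → Forces r φ ρ) → Forces p φ ρ
    forces-dense (i `∈ j) ρ p pP h = forcesMem-dense p (lookup ρ i) (lookup ρ j) h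
    forces-dense (i `≡ j) ρ p pP h = forcesEq-dense p (lookup ρ i) (lookup ρ j) pP h
    forces-dense (`¬ φ) ρ p pP h q l k =
      let r , rq , n = h q l in n r (⊴-refl r (proj₁ (⊴-dom rq))) (forces-mono φ ρ q r rq k)
    forces-dense (φ `∧ ψ) ρ p pP h =
      forces-dense φ ρ p pP (λ q l → let r , rq , k , _ = h q l in r , rq , k) ,
      forces-dense ψ ρ p pP (λ q l → let r , rq , _ , k = h q l in r , rq , k)
    forces-dense (`∃ φ) ρ p pP h q l =
      let r , rq , k = h q l
          r' , r'r , m = k r (⊴-refl r (proj₁ (⊴-dom rq)))
      in r' , ⊴-trans r' r q r'r rq , m

    forces-subst : ∀ {n} (φ : Formula n) ρ ρ' p → p ∈ P →
      (∀ i → ForcesEq p (lookup ρ i) (lookup ρ' i)) → Forces p φ ρ → Forces p φ ρ'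
    forces-subst (i `∈ j) ρ ρ' p pP e h =
      forcesMem-substʳ p (lookup ρ' i) (lookup ρ j) (lookup ρ' j) pP (e j)
        (forcesMem-substˡ p (lookup ρ i) (lookup ρ' i) (lookup ρ j) pP (e i) h)
    forces-subst (i `≡ j) ρ ρ' p pP e h =
      forcesEq-trans p (lookup ρ' i) (lookup ρ i) (lookup ρ' j) pP (forcesEq-sym p (lookup ρ i) (lookup ρ' i) pP (e i))
        (forcesEq-trans p (lookup ρ i) (lookup ρ j) (lookup ρ' j) pP h (e j))
    forces-subst (`¬ φ) ρ ρ' p pP e h q l k =
      let qP = proj₁ (⊴-dom l) in
      h q l (forces-subst φ ρ' ρ q qP
        (λ i → forcesEq-mono p q (lookup ρ' i) (lookup ρ i) l (forcesEq-sym p (lookup ρ i) (lookup ρ' i) pP (e i))) k)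
    forces-subst (φ `∧ ψ) ρ ρ' p pP e (h , k) = forces-subst φ ρ ρ' p pP e h , forces-subst ψ ρ ρ' p pP e k
    forces-subst (`∃ φ) ρ ρ' p pP e h q l =
      let r , rq , τ , n , k = h q l
          rP = proj₁ (⊴-dom rq)
      in r , rq , τ , n , forces-subst φ (τ ∷ ρ) (τ ∷ ρ') r rP
           (λ { zero → forcesEq-refl r τ rP
              ; (suc i) → forcesEq-mono p r (lookup ρ i) (lookup ρ' i) (⊴-trans r q p rq l) (e i) }) k

    NamesIn : Carrier → Carrier → Set ℓ
    NamesIn y N = ∀ z → z ∈ y → ∃[ p ] ∃[ σ ] p ∈ P × σ ∈ N × IsPair M z p σ

    -- NameRecursion is monotone in N, so the Knaster–Tarski fixed point exists.
    opaque
      nameRecursion-solvable : ∀ T → ∃[ N ] NameRecursion T N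
      nameRecursion-solvable T = N , λ y yT → mk⇔ (unfold y) (fold y yT)
        where
        namesInᶠ : ∀ {n} → Fin n → Fin n → Fin n → Fml n
        namesInᶠ P y N = ∀̇ (v0 ∈̇ ↑1 y ⇒̇ ∃̇ ∃̇ (v1 ∈̇ ↑3 P ∧̇ v0 ∈̇ ↑3 N ∧̇ pairᶠ v2 v1 v0))
        N-spec : ∃[ N ] (∀ y → y ∈ N ⇔ (y ∈ T ×
          (∀ S → (∀ u → u ∈ T → NamesIn u S → u ∈ S) → y ∈ S)))
        N-spec = sep (∀̇ (∀̇ (v0 ∈̇ v3 ⇒̇ namesInᶠ v4 v0 v1 ⇒̇ v0 ∈̇ v1) ⇒̇ v1 ∈̇ v0)) (T ∷ P ∷ []) T
        N : Carrier
        N = proj₁ N-spec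
        hN : ∀ y → y ∈ N ⇔ (y ∈ T × (∀ S → (∀ u → u ∈ T → NamesIn u S → u ∈ S) → y ∈ S))
        hN = proj₂ N-spec
        mono : ∀ {u A B} → A ⊆ B → NamesIn u A → NamesIn u B
        mono s h z i = let p , σ , pP , σA , e = h z i in p , σ , pP , s σ σA , e
        fold : ∀ y → y ∈ T → NamesIn y N → y ∈ N
        fold y yT h = from (hN y) (yT , λ S cl → cl y yT (mono (λ u i → proj₂ (to (hN u) i) S cl) h))
        S-spec : ∃[ S ] (∀ u → u ∈ S ⇔ (u ∈ T × NamesIn u N))
        S-spec = sep (namesInᶠ v1 v0 v2) (P ∷ N ∷ []) T
        unfold : ∀ y → y ∈ N → NamesIn y N
        unfold y i = let S , hS = S-spec in proj₂ (to (hS y) (proj₂ (to (hN y) i) S λ u uT h →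
          from (hS u) (uT , mono (λ w j → let wT , k = to (hS w) j in fold w wT k) h)))

    -- Each `IsName` brings its own `T'` and `N'`. To form a name out of many names, all of them
    -- have to be moved to one common solution.
    name-agrees : ∀ T N → Transitive M T → NameRecursion T N → ∀ σ → IsName σ → σ ∈ T → σ ∈ N
    name-agrees T N tr rec σ (T' , N' , tr' , rec' , iT' , iN') iT =
      let s , ls , is = level∋ σ in level-induction
        (∀̇ (v0 ∈̇ v1 ⇒̇ v0 ∈̇ v2 ⇒̇ v0 ∈̇ v3 ⇒̇ v0 ∈̇ v4 ⇒̇ v0 ∈̇ v5)) (T' ∷ N' ∷ T ∷ N ∷ [])
        (λ s ls ih y ys yT' yN' yT → from (rec y yT) λ z i →
          let t , lt , ts , yt = level-unfold s ls ys
              p , ϑ , pP , ϑN' , e = to (rec' y yT') yN' z i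
              ϑT' = proj₂ (pair-transitive tr' e (tr' z y i yT'))
              ϑT = proj₂ (pair-transitive tr e (tr z y i yT))
              ϑt = proj₂ (pair-transitive (level-transitive t lt) e (yt z i))
          in p , ϑ , pP , ih t lt ts ϑ ϑt ϑT' ϑN' ϑT , e)
        s ls σ is iT' iN' iT

    name-elim : ∀ y → IsName y → ∀ z → z ∈ y → ∃[ p ] ∃[ σ ] p ∈ P × IsName σ × IsPair M z p σ
    name-elim y (T , N , tr , rec , yT , yN) z i =
      let p , σ , pP , σN , e = to (rec y yT) yN z i
      in p , σ , pP , (T , N , tr , rec , proj₂ (pair-transitive tr e (tr z y i yT)) , σN) , e

    name-intro : ∀ y → (∀ z → z ∈ y → ∃[ p ] ∃[ σ ] p ∈ P × IsName σ × IsPair M z p σ) → IsName y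
    name-intro y h =
      let T , lT , yT = level∋ y
          tr = level-transitive T lT
          N , rec = nameRecursion-solvable T
      in T , N , tr , rec , yT , from (rec y yT) λ z i →
        let p , σ , pP , nσ , e = h z i
        in p , σ , pP , name-agrees T N tr rec σ nσ (proj₂ (pair-transitive tr e (tr z y i yT))) , e

-- Choice for definable relations, and maximal antichains

module Choice {ℓ : Level} (em : ExcludedMiddle ℓ) (M : Structure ℓ) (zf : ZF M) where
  open ForcingTheory em M zf public

  opaque
    -- Collection first bounds the witnesses by a set `u`; then `AC` is applied to the set of fibres
    -- inside `u`. Two elements of `A` with the same fibre receive the same value, which does no
    -- harm.
    choose : AC M → ∀ {n} (φ : Fml (suc (suc n))) ρ A → (∀ x → x ∈ A → ∃[ y ] ⟦ φ ⟧ (y ∷ x ∷ ρ)) →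
      ∃[ g ] (∀ x → x ∈ A → ∃[ y ] Pair∈ M x y g) ×
             (∀ x y → Pair∈ M x y g → x ∈ A × ⟦ φ ⟧ (y ∷ x ∷ ρ)) ×
             (∀ x y z → Pair∈ M x y g → Pair∈ M x z g → y ≡ z)
    choose ac φ ρ A ex =
      let u , lu , hu = collection φ ρ A ex
          G , _ , hG = relation (ren swap₀₁ φ) ρ A u
          swapped : ∀ {x y} → ⟦ ren swap₀₁ φ ⟧ (x ∷ y ∷ ρ) ⇔ ⟦ φ ⟧ (y ∷ x ∷ ρ)
          swapped = ⟦ren⟧ swap₀₁ φ (λ { v0 → refl ; v1 → refl ; (↑2 i) → refl })
          V , hV = ℘ u
          fiber-exists : ∀ x → ∃[ W ] (∀ y → y ∈ W ⇔ (y ∈ u × Pair∈ M x y G))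
          fiber-exists = λ x → sep (pair∈ᶠ v1 v0 v2) (x ∷ G ∷ []) u
          X , hX = sep (∃̇ (v0 ∈̇ v2 ∧̇ ∀̇ (v0 ∈̇ v2 ⇔̇ (v0 ∈̇ v4 ∧̇ pair∈ᶠ v1 v0 v5)))) (A ∷ u ∷ G ∷ []) V
          f , (_ , ftotal) , fchoice = ac X λ W i →
            let _ , x , xA , hW = to (hX W) i ; y , yu , k = hu x xA in
            y , from (hW y) (yu , from (hG x y) (xA , yu , from swapped k))
          g , _ , hg = relation (∃̇ (∀̇ (v0 ∈̇ v1 ⇔̇ (v0 ∈̇ v4 ∧̇ pair∈ᶠ v2 v0 v5)) ∧̇ pair∈ᶠ v0 v2 v5))
                         (u ∷ G ∷ f ∷ []) A u
          fiber∈X : ∀ x → x ∈ A → ∀ W → (∀ y → y ∈ W ⇔ (y ∈ u × Pair∈ M x y G)) → W ∈ X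
          fiber∈X = λ x xA W hW → from (hX W) (from (hV W) (λ y i → proj₁ (to (hW y) i)) , x , xA , hW)
      in g , (λ x xA →
        let W , hW = fiber-exists x
            y , p , _ = ftotal W (fiber∈X x xA W hW)
            yu = proj₁ (to (hW y) (fchoice W y (fiber∈X x xA W hW) p))
        in y , from (hg x y) (xA , yu , W , hW , p)) ,
      (λ x y i →
        let xA , yu , W , hW , p = to (hg x y) i
            j = proj₂ (to (hW y) (fchoice W y (fiber∈X x xA W hW) p))
        in xA , to swapped (proj₂ (proj₂ (to (hG x y) j)))) ,
      (λ x y z i j →
        let xA , yu , W , hW , p = to (hg x y) i
            _ , zu , W' , hW' , q = to (hg x z) j
            w , _ , un = ftotal W (fiber∈X x xA W hW)
            W≡ : W' ≡ W
            W≡ = ext (λ v k → from (hW v) (to (hW' v) k)) (λ v k → from (hW' v) (to (hW v) k))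
        in trans (sym (un p)) (un (subst (λ W → Pair∈ M W z f) W≡ q)))

  IsUnion : Carrier → Carrier → Set ℓ
  IsUnion U G = ∀ z → z ∈ U ⇔ (∃[ y ] z ∈ y × y ∈ G)

  IsInsert : Carrier → Carrier → Carrier → Set ℓ
  IsInsert B' B d = ∀ z → z ∈ B' ⇔ (z ∈ B ⊎ z ≡ d)

  -- `g` may be partial; where it is undefined no step starts.
  Step : Carrier → Carrier → Carrier → Set ℓ
  Step g B B' = ∃[ d ] Pair∈ M B d g × IsInsert B' B d

  -- There is no base clause: the empty set is the union of the empty `G`.
  Closed : Carrier → Carrier → Set ℓ
  Closed g F = (∀ B B' → B ∈ F → Step g B B' → B' ∈ F) × (∀ G U → G ⊆ F → IsUnion U G → U ∈ F)

  unionᶠ closedᶠ : ∀ {n} → Fin n → Fin n → Fml n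
  stepᶠ : ∀ {n} → Fin n → Fin n → Fin n → Fml n
  unionᶠ U G = atom {P = IsUnion} (define (∀̇ (v0 ∈̇ v1 ⇔̇ ∃̇ (v1 ∈̇ v0 ∧̇ v0 ∈̇ v3)))
    λ { (U ∷ G ∷ []) → mk⇔ id id }) (U ∷ G ∷ [])
  stepᶠ g B B' = atom {P = Step} (define
    (∃̇ (pair∈ᶠ v2 v0 v1 ∧̇ ∀̇ (v0 ∈̇ v4 ⇔̇ (v0 ∈̇ v3 ∨̇ v0 ≡̇ v1))))
    λ { (g ∷ B ∷ B' ∷ []) → mk⇔ id id }) (g ∷ B ∷ B' ∷ [])
  closedᶠ g F = atom {P = Closed} (define
    (∀̇ ∀̇ (v1 ∈̇ v3 ⇒̇ stepᶠ v2 v1 v0 ⇒̇ v0 ∈̇ v3) ∧̇ ∀̇ ∀̇ (v1 ⊆̇ v3 ⇒̇ unionᶠ v0 v1 ⇒̇ v0 ∈̇ v3))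
    λ { (g ∷ F ∷ []) → mk⇔ id id }) (g ∷ F ∷ [])

  -- Zermelo's argument: the least family closed under adjoining the chosen
  -- element and under unions is a chain.
  module Tower (D g : Carrier)
    (range : ∀ B d → Pair∈ M B d g → d ∈ D)
    (functional : ∀ B d e → Pair∈ M B d g → Pair∈ M B e g → d ≡ e) where

    opaque
      tower-spec : ∃[ T ] (∀ B → B ∈ T ⇔ (B ⊆ D × (∀ F → Closed g F → B ∈ F)))
      tower-spec =
        let V , hV = ℘ D ; T , hT = sep (∀̇ (closedᶠ v2 v0 ⇒̇ v1 ∈̇ v0)) (g ∷ []) V in
        T , λ B → mk⇔ (λ i → let j , h = to (hT B) i in to (hV B) j , h)
                      (λ (j , h) → from (hT B) (from (hV B) j , h))

    T : Carrier
    T = proj₁ tower-spec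

    tower-⊆ : ∀ B → B ∈ T → B ⊆ D
    tower-⊆ B i = proj₁ (to (proj₂ tower-spec B) i)

    tower-least : ∀ F → Closed g F → T ⊆ F
    tower-least F cl B i = proj₂ (to (proj₂ tower-spec B) i) F cl

    tower-closed : Closed g T
    tower-closed =
      (λ { B B' i st@(d , p , h) → from (proj₂ tower-spec B')
        ( (λ z j → [ tower-⊆ B i z , (λ e → subst (_∈ D) (sym e) (range B d p)) ]′ (to (h z) j))
        , λ F cl → proj₁ cl B B' (tower-least F cl B i) st) }) ,
      (λ G U sub h → from (proj₂ tower-spec U)
        ( (λ z j → let y , zy , yG = to (h z) j in tower-⊆ y (sub y yG) z zy)
        , λ F cl → proj₂ cl G U (λ y yG → tower-least F cl y (sub y yG)) h))

    tower-induction : ∀ {n} (φ : Fml (suc n)) ρ →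
      (∀ B B' → B ∈ T → ⟦ φ ⟧ (B ∷ ρ) → Step g B B' → ⟦ φ ⟧ (B' ∷ ρ)) →
      (∀ G U → (∀ B → B ∈ G → ⟦ φ ⟧ (B ∷ ρ)) → G ⊆ T → IsUnion U G → ⟦ φ ⟧ (U ∷ ρ)) →
      ∀ B → B ∈ T → ⟦ φ ⟧ (B ∷ ρ)
    tower-induction φ ρ step union B i =
      let F , hF = sep φ ρ T in
      proj₂ (to (hF B) (tower-least F
        ( (λ B B' j st → let jT , k = to (hF B) j in
             from (hF B') (proj₁ tower-closed B B' jT st , step B B' jT k st))
        , (λ G U sub h →
             let subT = λ B j → proj₁ (to (hF B) (sub B j)) in
             from (hF U) (proj₂ tower-closed G U subT h , union G U (λ B j → proj₂ (to (hF B) (sub B j))) subT h)))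
        B i))

    step-unique : ∀ B B' B'' → Step g B B' → Step g B B'' → B' ⊆ B''
    step-unique B B' B'' (d , p , h) (e , q , k) z i =
      from (k z) ([ inj₁ , (λ z≡d → inj₂ (trans z≡d (functional B d e p q))) ]′ (to (h z) i))

    -- The critical case is `A ⊆ C ⊆ A'` where `A'` adds `d` to `A`. If `d ∈ C`, then `A' ⊆ C`.
    -- Otherwise `C ⊆ A`, so `C` equals `A` and both have the same successor, `g` being functional.
    step-gap : ∀ C C' → Step g C C' → (∀ A → A ∈ T → A ⊆ C ⊎ C ⊆ A) → ∀ A → A ∈ T → A ⊆ C ⊎ C' ⊆ A
    step-gap C C' stC comp = tower-induction (v0 ⊆̇ v1 ∨̇ v2 ⊆̇ v0) (C ∷ C' ∷ []) step limit
      where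
      step : ∀ A A' → A ∈ T → A ⊆ C ⊎ C' ⊆ A → Step g A A' → A' ⊆ C ⊎ C' ⊆ A'
      step A A' i (inj₂ k) (d , p , h) = inj₂ λ z j → from (h z) (inj₁ (k z j))
      step A A' i (inj₁ k) st@(d , p , h) with comp A' (proj₁ tower-closed A A' i st) | em {d ∈ C}
      ... | inj₁ l | _ = inj₁ l
      ... | inj₂ l | yes dC = inj₁ λ z j → [ k z , (λ e → subst (_∈ C) (sym e) dC) ]′ (to (h z) j)
      ... | inj₂ l | no dC = inj₂ (step-unique A C' A' (subst (λ X → Step g X C') C≡A stC) st)
        where
        C≡A : C ≡ A
        C≡A = ext (λ z j → [ id , (λ e → ⊥-elim (dC (subst (_∈ C) e j))) ]′ (to (h z) (l z j))) k
      limit : ∀ G U → (∀ A → A ∈ G → A ⊆ C ⊎ C' ⊆ A) → G ⊆ T → IsUnion U G → U ⊆ C ⊎ C' ⊆ U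
      limit G U ih _ h with em {∃[ A ] A ∈ G × C' ⊆ A}
      ... | yes (A , i , k) = inj₂ λ z j → from (h z) (A , k z j , i)
      ... | no n = inj₁ λ z j → let A , zA , AG = to (h z) j in
        [ (λ k → k z zA) , (λ k → ⊥-elim (n (A , AG , k))) ]′ (ih A AG)

    tower-chain : ∀ C → C ∈ T → ∀ A → A ∈ T → A ⊆ C ⊎ C ⊆ A
    tower-chain = tower-induction (∀̇ (v0 ∈̇ v2 ⇒̇ v0 ⊆̇ v1 ∨̇ v1 ⊆̇ v0)) (T ∷ [])
      (λ { C C' i ih st@(d , p , h) A j → [ (λ k → inj₁ λ z l → from (h z) (inj₁ (k z l))) , inj₂ ]′ (step-gap C C' st ih A j) })
      limit
      where
      limit : ∀ G U → (∀ C → C ∈ G → ∀ A → A ∈ T → A ⊆ C ⊎ C ⊆ A) → G ⊆ T → IsUnion U G →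
        ∀ A → A ∈ T → A ⊆ U ⊎ U ⊆ A
      limit G U ih _ h A j with em {∃[ C ] C ∈ G × A ⊆ C}
      ... | yes (C , i , k) = inj₁ λ z l → from (h z) (C , k z l , i)
      ... | no n = inj₂ λ z l → let C , zC , CG = to (h z) l in
        [ (λ k → ⊥-elim (n (C , CG , k))) , (λ k → k z zC) ]′ (ih C CG A j)

  opaque
    -- `g` assigns to each extendible subset of `D` an element unrelated to all its members, so the
    -- tower built from `g` consists of antichains, and being a chain it has an antichain as its
    -- union.
    maximal-antichain : AC M → ∀ D K → (∀ d → d ∈ D → Pair∈ M d d K) →
      (∀ a b → Pair∈ M a b K → Pair∈ M b a K) →
      ∃[ A ] A ⊆ D × (∀ a b → a ∈ A → b ∈ A → Pair∈ M a b K → a ≡ b) ×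
             (∀ d → d ∈ D → ∃[ a ] a ∈ A × Pair∈ M a d K)
    maximal-antichain ac D K rfl symm =
      let V , hV = ℘ D
          ext?ᶠ : Fml 4
          ext?ᶠ = v0 ∈̇ v2 ∧̇ ∀̇ (v0 ∈̇ v2 ⇒̇ ¬̇ pair∈ᶠ v0 v1 v4)
          X , hX = sep (∃̇ ext?ᶠ) (D ∷ K ∷ []) V
          g , total , spec , functional = choose ac ext?ᶠ (D ∷ K ∷ []) X (λ B i → proj₂ (to (hX B) i))
          range = λ B d p → proj₁ (proj₂ (spec B d p))
          fresh : ∀ B d a → Pair∈ M B d g → a ∈ B → ¬ Pair∈ M a d K
          fresh = λ B d a p i → proj₂ (proj₂ (spec B d p)) a i
      in from-tower V hV X hX g total range fresh functional
      where
      from-tower : ∀ V → (∀ z → z ∈ V ⇔ z ⊆ D) → ∀ X →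
        (∀ B → B ∈ X ⇔ (B ∈ V × (∃[ d ] d ∈ D × (∀ a → a ∈ B → ¬ Pair∈ M a d K)))) →
        ∀ g → (∀ B → B ∈ X → ∃[ d ] Pair∈ M B d g) → (∀ B d → Pair∈ M B d g → d ∈ D) →
        (∀ B d a → Pair∈ M B d g → a ∈ B → ¬ Pair∈ M a d K) →
        (∀ B d e → Pair∈ M B d g → Pair∈ M B e g → d ≡ e) →
        ∃[ A ] A ⊆ D × (∀ a b → a ∈ A → b ∈ A → Pair∈ M a b K → a ≡ b) ×
               (∀ d → d ∈ D → ∃[ a ] a ∈ A × Pair∈ M a d K)
      from-tower V hV X hX g total range fresh functional =
        A , tower-⊆ A AT , antichain A AT , λ d dD → dne λ n →
          -- If `A` were extendible, adding `e` would stay in the tower, so `e ∈ A` because `A` is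
          -- the union of the tower. But `e` is unrelated to every member of `A`, against
          -- reflexivity.
          let e , p = total A (from (hX A) (from (hV A) (tower-⊆ A AT) , d , dD , λ a aA k → n (a , aA , k)))
              A' , hA' = insert A e
              A'T = proj₁ tower-closed A A' AT (e , p , hA')
              eA = from (hA e) (A' , from (hA' e) (inj₂ refl) , A'T)
          in fresh A e e p eA (rfl e (range A e p))
        where
        open Tower D g range functional
        A : Carrier
        A = proj₁ (⋃ T)
        hA : IsUnion A T
        hA = proj₂ (⋃ T)
        AT : A ∈ T
        AT = proj₂ tower-closed T A (λ _ i → i) hA
        antichain : ∀ B → B ∈ T → ∀ a b → a ∈ B → b ∈ B → Pair∈ M a b K → a ≡ b
        antichain = tower-induction
          (∀̇ ∀̇ (v1 ∈̇ v2 ⇒̇ v0 ∈̇ v2 ⇒̇ pair∈ᶠ v1 v0 v3 ⇒̇ v1 ≡̇ v0)) (K ∷ [])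
          (λ { B B' _ ih (d , p , h) a b i j k →
            [ (λ i' → [ (λ j' → ih a b i' j' k)
                      , (λ b≡d → ⊥-elim (fresh B d a p i' (subst (λ x → Pair∈ M a x K) b≡d k))) ]′ (to (h b) j))
            , (λ a≡d → [ (λ j' → ⊥-elim (fresh B d b p j' (subst (λ x → Pair∈ M b x K) a≡d (symm a b k))))
                       , (λ b≡d → trans a≡d (sym b≡d)) ]′ (to (h b) j)) ]′ (to (h a) i) })
          (λ G U ih sub h a b i j k →
            let B , aB , BG = to (h a) i ; C , bC , CG = to (h b) j in
            [ (λ BC → ih C CG a b (BC a aB) bC k) , (λ CB → ih B BG a b aB (CB b bC) k) ]′
              (tower-chain C (sub C CG) B (sub B BG)))

-- Mixing names: from choice to the maximum principle

module Mixing {ℓ : Level} (em : ExcludedMiddle ℓ) (M : Structure ℓ) (zf : ZF M) where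
  open Choice em M zf public

  module Mix (P R : Carrier) (po : IsPartialOrder M P R) where
    open Order P R po

    Compatible : Carrier → Carrier → Set ℓ
    Compatible a b = ∃[ u ] u ⊴ a × u ⊴ b

    opaque
      mixture : ∀ A g → ∃[ τ ] (∀ z → z ∈ τ → ∃[ s ] ∃[ σ ] s ∈ P × IsPair M z s σ × Pair∈ M s σ τ) ×
        (∀ s σ → Pair∈ M s σ τ ⇔ (∃[ r ] r ∈ A × s ⊴ r × (∃[ τᵣ ] Pair∈ M r τᵣ g × (∃[ t ] Pair∈ M t σ τᵣ × s ⊴ t))))
      mixture A g =
        -- A transitive set containing `g` also contains every name occurring in some `τᵣ`, and so
        -- bounds the second coordinates.
        let S , lS , gS = level∋ g
            trS = level-transitive S lS
            τ , pairs , hτ = relation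
              (∃̇ (v0 ∈̇ v3 ∧̇ pair∈ᶠ v1 v0 v5 ∧̇ ∃̇ (pair∈ᶠ v1 v0 v5 ∧̇ ∃̇ (pair∈ᶠ v0 v4 v1 ∧̇ pair∈ᶠ v3 v0 v7))))
              (A ∷ g ∷ R ∷ []) P S
        in τ ,
           (λ z i → let s , σ , sP , _ , e = pairs z i in s , σ , sP , e , z , e , i) ,
           λ s σ → mk⇔ (λ i → proj₂ (proj₂ (to (hτ s σ) i)))
             (λ { h@(r , rA , sr , τᵣ , i , t , j , st) → from (hτ s σ)
               ( proj₁ (⊴-dom sr)
               , proj₂ (pair∈-transitive trS j (proj₂ (pair∈-transitive trS i gS)))
               , h) })

    -- A pair of the mixture usable below `r` stems from some `r'` compatible with `r`, hence from
    -- `r` itself. Conversely, if `(t , σ)` from `τᵣ` is used at `u`, then `(u , σ)` is in the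
    -- mixture, as `u` is below both `r` and `t`.
    forces-mixture : ∀ A g → (∀ a b → a ∈ A → b ∈ A → Compatible a b → a ≡ b) →
      (∀ x y z → Pair∈ M x y g → Pair∈ M x z g → y ≡ z) →
      ∀ r τᵣ → r ∈ A → Pair∈ M r τᵣ g → r ∈ P → ForcesEq r (proj₁ (mixture A g)) τᵣ
    forces-mixture A g antichain functional r τᵣ rA rτᵣ rP =
      from (forcesEq-unfold r τ τᵣ rP) λ ϑ _ q l → mk⇔ (fwd ϑ q l) (bwd ϑ q l)
      where
      τ : Carrier
      τ = proj₁ (mixture A g)
      hτ : ∀ s σ → Pair∈ M s σ τ ⇔ (∃[ r ] r ∈ A × s ⊴ r × (∃[ τᵣ ] Pair∈ M r τᵣ g × (∃[ t ] Pair∈ M t σ τᵣ × s ⊴ t)))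
      hτ = proj₂ (proj₂ (mixture A g))
      fwd : ∀ ϑ q → q ⊴ r → ForcesMem q ϑ τ → ForcesMem q ϑ τᵣ
      fwd ϑ q l m q' l' =
        let u , uq' , s , σ , i , us , e = m q' l'
            r' , r'A , sr' , τ' , j , t , k , st = to (hτ s σ) i
            r≡r' = antichain r r' rA r'A
              (u , ⊴-trans u q' r uq' (⊴-trans q' q r l' l) , ⊴-trans u s r' us sr')
            τ'≡ = functional r τ' τᵣ (subst (λ x → Pair∈ M x τ' g) (sym r≡r') j) rτᵣ
        in u , uq' , t , σ , subst (Pair∈ M t σ) τ'≡ k , ⊴-trans u s t us st , e
      bwd : ∀ ϑ q → q ⊴ r → ForcesMem q ϑ τᵣ → ForcesMem q ϑ τ
      bwd ϑ q l m q' l' =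
        let u , uq' , t , σ , k , ut , e = m q' l' in
        u , uq' , u , σ ,
        from (hτ u σ) (r , rA , ⊴-trans u q' r uq' (⊴-trans q' q r l' l) , τᵣ , rτᵣ , t , k , ut) ,
        ⊴-refl u (proj₁ (⊴-dom uq')) , e

    mixture-name : ∀ A g → (∀ r τᵣ → Pair∈ M r τᵣ g → IsName τᵣ) → IsName (proj₁ (mixture A g))
    mixture-name A g names = name-intro _ λ z i →
      let s , σ , sP , e , sσ = proj₁ (proj₂ (mixture A g)) z i
          r , _ , _ , τᵣ , j , t , (w , ew , wτᵣ) , _ = to (proj₂ (proj₂ (mixture A g)) s σ) sσ
          p , σ' , _ , nσ' , ew' = name-elim τᵣ (names r τᵣ j) w wτᵣ
      in s , σ , sP , subst IsName (proj₂ (pair-injective ew' ew)) nσ' , e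

    Witnessed : ∀ {n} → Formula (suc n) → Vec Carrier n → Carrier → Set ℓ
    Witnessed θ ρ r = ∃[ τ ] IsName τ × Forces r θ (τ ∷ ρ)

    -- The parameters start at position 5, behind the witness, its condition, one further set, `P`
    -- and `R`.
    witness-env : ∀ {n} → Fin (suc n) → Fin (5 + n)
    witness-env zero    = v0
    witness-env (suc i) = suc (↑4 i)

    witnessᶠ : ∀ {n} → Formula (suc n) → Fml (5 + n)
    witnessᶠ θ = isNameᶠ v3 v4 v0 ∧̇ forcesᶠ θ v3 v4 v1 witness-env

    ⟦witness⟧ : ∀ {n} (θ : Formula (suc n)) τ r p ρ →
      ⟦ witnessᶠ θ ⟧ (τ ∷ r ∷ p ∷ P ∷ R ∷ ρ) ⇔ (IsName τ × Forces r θ (τ ∷ ρ))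
    ⟦witness⟧ θ τ r p ρ = mk⇔ (λ (n , f) → n , to h f) (λ (n , f) → n , from h f)
      where
      h : ⟦ forcesᶠ θ v3 v4 v1 witness-env ⟧ (τ ∷ r ∷ p ∷ P ∷ R ∷ ρ) ⇔ Forces r θ (τ ∷ ρ)
      h = ⟦forces⟧ θ v3 v4 v1 witness-env {τ ∷ r ∷ p ∷ P ∷ R ∷ ρ} {τ ∷ ρ} λ { zero → refl ; (suc i) → refl }

    opaque
      witnessed-below : ∀ {n} (θ : Formula (suc n)) ρ p →
        ∃[ D ] (∀ r → r ∈ D ⇔ (r ∈ P × r ⊴ p × Witnessed θ ρ r))
      witnessed-below θ ρ p =
        let D , hD = sep (pair∈ᶠ v0 v1 v3 ∧̇ ∃̇ witnessᶠ θ) (p ∷ P ∷ R ∷ ρ) P in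
        D , λ r → mk⇔
          (λ i → let rP , rp , τ , h = to (hD r) i in rP , rp , τ , to (⟦witness⟧ θ τ r p ρ) h)
          (λ (rP , rp , τ , h) → from (hD r) (rP , rp , τ , from (⟦witness⟧ θ τ r p ρ) h))

      choose-witnesses : AC M → ∀ {n} (θ : Formula (suc n)) ρ A → (∀ r → r ∈ A → Witnessed θ ρ r) →
        ∃[ g ] (∀ r → r ∈ A → ∃[ τ ] Pair∈ M r τ g) ×
               (∀ r τ → Pair∈ M r τ g → IsName τ × Forces r θ (τ ∷ ρ)) ×
               (∀ x y z → Pair∈ M x y g → Pair∈ M x z g → y ≡ z)
      choose-witnesses ac θ ρ A h =
        let g , total , spec , functional = choose ac (witnessᶠ θ) (A ∷ P ∷ R ∷ ρ) A
              (λ r i → let τ , k = h r i in τ , from (⟦witness⟧ θ τ r A ρ) k)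
        in g , total , (λ r τ i → to (⟦witness⟧ θ τ r A ρ) (proj₂ (spec r τ i))) , functional

      compatibility : ∀ D → ∃[ K ] (∀ a b → Pair∈ M a b K ⇔ (a ∈ D × b ∈ D × Compatible a b))
      compatibility D =
        let K , _ , hK = relation (∃̇ (pair∈ᶠ v0 v1 v3 ∧̇ pair∈ᶠ v0 v2 v3)) (R ∷ []) D D in K , hK

      maximum-principle : AC M → ∀ {n} (θ : Formula (suc n)) ρ p → p ∈ P →
        Forces p (`∃ θ) ρ → Witnessed θ ρ p
      maximum-principle ac θ ρ p pP f =
        let D , hD = witnessed-below θ ρ p
            K , hK = compatibility D
            D⊆P : D ⊆ P
            D⊆P = λ d i → proj₁ (to (hD d) i)
            A , A⊆D , antichain , maximal = maximal-antichain ac D K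
              (λ d i → from (hK d d) (i , i , d , ⊴-refl d (D⊆P d i) , ⊴-refl d (D⊆P d i)))
              (λ a b i → let aD , bD , u , ua , ub = to (hK a b) i in from (hK b a) (bD , aD , u , ub , ua))
            g , total , spec , functional = choose-witnesses ac θ ρ A
              (λ r i → proj₂ (proj₂ (to (hD r) (A⊆D r i))))
            τ = proj₁ (mixture A g)
        in τ , mixture-name A g (λ r τᵣ i → proj₁ (spec r τᵣ i)) ,
           -- Below `q` there is some `d ∈ D`, as `p` forces the existential. By maximality `d` is
           -- compatible with some `a ∈ A`, and a common extension `u` forces `τ` to equal the
           -- witness chosen for `a`.
           forces-dense θ (τ ∷ ρ) p pP λ q l →
             let d , dq , τ' , n , k = f q l
                 dP = proj₁ (⊴-dom dq)
                 dD = from (hD d) (dP , ⊴-trans d q p dq l , τ' , n , k)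
                 a , aA , ad = maximal d dD
                 _ , _ , u , ua , ud = to (hK a d) ad
                 τᵣ , aτᵣ = total a aA
                 uP , aP = ⊴-dom ua
                 e = forces-mixture A g
                   (λ a b i j c → antichain a b i j (from (hK a b) (A⊆D a i , A⊆D b j , c)))
                   functional a τᵣ aA aτᵣ aP
             in u , ⊴-trans u d q ud dq ,
                forces-subst θ (τᵣ ∷ ρ) (τ ∷ ρ) u uP
                  (λ { zero → forcesEq-sym u τ τᵣ uP (forcesEq-mono a u τ τᵣ ua e)
                     ; (suc i) → forcesEq-refl u (lookup ρ i) uP })
                  (forces-mono θ (τᵣ ∷ ρ) a u ua (proj₂ (spec a τᵣ aτᵣ)))

    witnessed-forces-∃ : ∀ {n} (θ : Formula (suc n)) ρ p → Witnessed θ ρ p → Forces p (`∃ θ) ρ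
    witnessed-forces-∃ θ ρ p (τ , n , f) q l =
      q , ⊴-refl q (proj₁ (⊴-dom l)) , τ , n , forces-mono θ (τ ∷ ρ) p q l f

  AC⇒MP : AC M → MaximumPrinciple M
  AC⇒MP ac θ P R po p pP ρ _ = mk⇔ (maximum-principle ac θ ρ p pP) (witnessed-forces-∃ θ ρ p)
    where open Mix P R po

-- Check names over a flat order: from the maximum principle to choice

module CheckNames {ℓ : Level} (em : ExcludedMiddle ℓ) (M : Structure ℓ) (zf : ZF M) where
  open Mixing em M zf public

  -- A certificate relates sets u to check names d = {(t , ž) : z ∈ u}; unions of
  -- certificates are certificates, so no uniqueness of d is needed.
  Certificate : Carrier → Carrier → Set ℓ
  Certificate t G = ∀ u d → Pair∈ M u d G →
    (∀ w → w ∈ d → ∃[ z ] ∃[ e ] z ∈ u × Pair∈ M z e G × IsPair M w t e) ×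
    (∀ z → z ∈ u → ∃[ e ] Pair∈ M z e G × Pair∈ M t e d)

  certificateᶠ : ∀ {n} → Fin n → Fin n → Fml n
  certificateᶠ t G = atom {P = Certificate} (define
    (∀̇ ∀̇ (pair∈ᶠ v1 v0 v3 ⇒̇
      ∀̇ (v0 ∈̇ v1 ⇒̇ ∃̇ ∃̇ (v1 ∈̇ v4 ∧̇ pair∈ᶠ v1 v0 v6 ∧̇ pairᶠ v2 v5 v0)) ∧̇
      ∀̇ (v0 ∈̇ v2 ⇒̇ ∃̇ (pair∈ᶠ v1 v0 v5 ∧̇ pair∈ᶠ v4 v0 v2))))
    λ { (t ∷ G ∷ []) → mk⇔ id id }) (t ∷ G ∷ [])

  opaque
    certificate-union : ∀ t U → (∀ G → G ∈ U → Certificate t G) →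
      ∃[ G ] Certificate t G × (∀ F x y → F ∈ U → Pair∈ M x y F → Pair∈ M x y G)
    certificate-union t U cert =
      let G , hG = ⋃ U
          up : ∀ F x y → F ∈ U → Pair∈ M x y F → Pair∈ M x y G
          up = λ F x y FU (p , e , i) → p , e , from (hG p) (F , i , FU)
      in G ,
         (λ u d (p , ep , i) →
           let F , pF , FU = to (hG p) i
               c₁ , c₂ = cert F FU u d (p , ep , pF)
           in (λ w j → let z , e , zu , ze , h = c₁ w j in z , e , zu , up F z e FU ze , h) ,
              (λ z zu → let e , ze , h = c₂ z zu in e , up F z e FU ze , h)) ,
         up

    -- The certificates for the members of `y` are not unique, so collection gathers some for each
    -- member and their union is taken, with no choice made.
    certificate-cover : ∀ t y → (∀ z → z ∈ y → ∃[ G ] Certificate t G × (∃[ e ] Pair∈ M z e G)) →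
      ∃[ G ] Certificate t G × (∀ z → z ∈ y → ∃[ e ] Pair∈ M z e G)
    certificate-cover t y h =
      let u , _ , hu = collection (certificateᶠ v2 v0 ∧̇ ∃̇ pair∈ᶠ v2 v0 v1) (t ∷ []) y h
          U , hU = sep (certificateᶠ v1 v0) (t ∷ []) u
          G , cert , up = certificate-union t U (λ F i → proj₂ (to (hU F) i))
      in G , cert , λ z i → let F , Fu , c , e , k = hu z i in e , up F z e (from (hU F) (Fu , c)) k

    check-name : ∀ t y G → ∃[ c ] (∀ w → w ∈ c → ∃[ e ] IsPair M w t e × Pair∈ M t e c) ×
      (∀ e → Pair∈ M t e c ⇔ (∃[ z ] z ∈ y × Pair∈ M z e G))
    check-name t y G =
      let S , lS , GS = level∋ G
          one , h1 = upair t t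
          c , pairs , hc = relation (∃̇ (v0 ∈̇ v3 ∧̇ pair∈ᶠ v0 v2 v4)) (y ∷ G ∷ []) one S
      in c ,
         (λ w i → let s , e , s1 , _ , p = pairs w i
                      p' = subst (λ s → IsPair M w s e) ([ id , id ]′ (to (h1 s) s1)) p
                  in e , p' , w , p' , i) ,
         λ e → mk⇔ (λ i → proj₂ (proj₂ (to (hc t e) i)))
                    (λ { k@(z , _ , ze) → from (hc t e)
                       (from (h1 t) (inj₁ refl) , proj₂ (pair∈-transitive (level-transitive S lS) ze GS) , k) })

    certificate-extend : ∀ t y G → Certificate t G → (∀ z → z ∈ y → ∃[ e ] Pair∈ M z e G) →
      ∃[ F ] Certificate t F × (∃[ c ] Pair∈ M y c F)
    certificate-extend t y G cert cover =
      let c , pairs , hc = check-name t y G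
          F , hF = insert-pair G y c
          up : ∀ a b → Pair∈ M a b G → Pair∈ M a b F
          up = λ a b i → from (hF a b) (inj₁ i)
          cert-y : (∀ w → w ∈ c → ∃[ z ] ∃[ e ] z ∈ y × Pair∈ M z e F × IsPair M w t e) ×
                   (∀ z → z ∈ y → ∃[ e ] Pair∈ M z e F × Pair∈ M t e c)
          cert-y = (λ w i → let e , p , j = pairs w i ; z , zy , ze = to (hc e) j in z , e , zy , up z e ze , p) ,
                   (λ z zy → let e , ze = cover z zy in e , up z e ze , from (hc e) (z , zy , ze))
      in F , (λ u d i → [ (λ j → let c₁ , c₂ = cert u d j in
                 (λ w k → let z , e , zu , ze , h = c₁ w k in z , e , zu , up z e ze , h) ,
                 (λ z zu → let e , ze , h = c₂ z zu in e , up z e ze , h))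
               , (λ (u≡y , d≡c) →
                 (λ w k → let z , e , zy , ze , p = proj₁ cert-y w (subst (w ∈_) d≡c k) in
                          z , e , subst (z ∈_) (sym u≡y) zy , ze , p) ,
                 (λ z zu → let e , ze , h = proj₂ cert-y z (subst (z ∈_) u≡y zu) in
                           e , ze , subst (Pair∈ M t e) (sym d≡c) h)) ]′ (to (hF u d) i)) ,
         c , from (hF y c) (inj₂ (refl , refl))

    certificate-exists : ∀ t y → ∃[ G ] Certificate t G × (∃[ c ] Pair∈ M y c G)
    certificate-exists t = ∈-induction (∃̇ (certificateᶠ v2 v0 ∧̇ ∃̇ pair∈ᶠ v2 v0 v1)) (t ∷ [])
      λ y ih → let G , cert , cover = certificate-cover t y ih in certificate-extend t y G cert cover

  -- The order consisting of the atoms x ∈ X below the top element X.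
  module Antichain (X : Carrier) where

    opaque
      flat-order : ∃[ P ] ∃[ R ] IsPartialOrder M P R ×
        (∀ p → p ∈ P ⇔ (p ∈ X ⊎ p ≡ X)) × (∀ p q → Pair∈ M p q R ⇔ (p ∈ P × q ∈ P × (p ≡ q ⊎ q ≡ X)))
      flat-order =
        -- By foundation `X` is not an element of itself, so it is a new point and can serve as the
        -- top.
        let P , hP = insert X X
            R , pairs , hR = relation (v0 ≡̇ v1 ∨̇ v1 ≡̇ v2) (X ∷ []) P P
        in P , R , record
          { relation = pairs
          ; reflexive = λ p pP → from (hR p p) (pP , pP , inj₁ refl)
          ; transitive = λ p q r pq qr →
              let pP , _ , h = to (hR p q) pq ; _ , rP , k = to (hR q r) qr in
              from (hR p r) (pP , rP ,
                [ (λ q≡r → [ (λ p≡q → inj₁ (trans p≡q q≡r))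
                           , (λ q≡X → inj₂ (trans (sym q≡r) q≡X)) ]′ h)
                , inj₂ ]′ k)
          ; antisymmetric = λ p q pq qp →
              let _ , _ , h = to (hR p q) pq ; _ , _ , k = to (hR q p) qp in
              [ id , (λ q≡X → [ sym , (λ p≡X → trans p≡X (sym q≡X)) ]′ k) ]′ h
          } , hP , hR

    P R : Carrier
    P = proj₁ flat-order
    R = proj₁ (proj₂ flat-order)

    po : IsPartialOrder M P R
    po = proj₁ (proj₂ (proj₂ flat-order))

    hP : ∀ p → p ∈ P ⇔ (p ∈ X ⊎ p ≡ X)
    hP = proj₁ (proj₂ (proj₂ (proj₂ flat-order)))

    hR : ∀ p q → Pair∈ M p q R ⇔ (p ∈ P × q ∈ P × (p ≡ q ⊎ q ≡ X))
    hR = proj₂ (proj₂ (proj₂ (proj₂ flat-order)))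

    open Order P R po

    X∈P : X ∈ P
    X∈P = from (hP X) (inj₂ refl)

    ∈X⇒∈P : ∀ {x} → x ∈ X → x ∈ P
    ∈X⇒∈P {x} i = from (hP x) (inj₁ i)

    below-top : ∀ p → p ∈ P → p ⊴ X
    below-top p pP = from (hR p X) (pP , X∈P , inj₂ refl)

    atomic : ∀ p x → x ∈ X → p ⊴ x → p ≡ x
    atomic p x xX l = [ id , (λ x≡X → ⊥-elim (∈-irrefl X (subst (_∈ X) x≡X xX))) ]′ (proj₂ (proj₂ (to (hR p x) l)))

    -- Nothing but the atom lies below it, so the density quantifiers collapse and a single pair of
    -- `b` settles the membership.
    forcesMem-atom : ∀ x a b → x ∈ X → ForcesMem x a b →
      ∃[ s ] ∃[ σ ] Pair∈ M s σ b × x ⊴ s × ForcesEq x a σ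
    forcesMem-atom x a b xX h =
      let r , rx , s , σ , i , rs , e = h x (⊴-refl x (∈X⇒∈P xX))
          r≡x = atomic r x xX rx
      in s , σ , i , subst (_⊴ s) r≡x rs , subst (λ r → ForcesEq r a σ) r≡x e

    module _ (G : Carrier) (cert : Certificate X G) where

      check-is-name : ∀ y c → Pair∈ M y c G → IsName c
      check-is-name = ∈-induction (∀̇ (pair∈ᶠ v1 v0 v2 ⇒̇ isNameᶠ v3 v4 v0)) (G ∷ P ∷ R ∷ [])
        λ y ih c i → name-intro c λ w j →
          let z , e , zy , ze , p = proj₁ (cert y c i) w j in X , e , X∈P , ih z zy e ze , p

      forcesMem-check : ∀ x a z d → x ∈ X → Pair∈ M z d G → ForcesMem x a d →
        ∃[ v ] ∃[ b ] v ∈ z × Pair∈ M v b G × ForcesEq x a b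
      forcesMem-check x a z d xX i h =
        let s , σ , (w , p , j) , _ , e = forcesMem-atom x a d xX h
            v , b , vz , vb , q = proj₁ (cert z d i) w j
        in v , b , vz , vb , subst (ForcesEq x a) (proj₂ (pair-injective p q)) e

      -- All pairs of a check name carry the top as condition. So the name of a member of `y` is
      -- forced into `c`, hence into `d`, and is there forced equal to the name of some member of
      -- `z`; induction identifies the two members.
      check-separated : ∀ x → x ∈ X → ∀ y z c d → Pair∈ M y c G → Pair∈ M z d G → ForcesEq x c d → y ≡ z
      check-separated x xX = ∈-induction
        (∀̇ ∀̇ ∀̇ (pair∈ᶠ v3 v1 v4 ⇒̇ pair∈ᶠ v2 v0 v4 ⇒̇ forcesEqᶠ v5 v6 v7 v1 v0 ⇒̇ v3 ≡̇ v2))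
        (G ∷ P ∷ R ∷ x ∷ [])
        λ y ih z c d yc zd e →
          let xP = ∈X⇒∈P xX
              x≤ = ⊴-refl x xP
              unfolded : ∀ ϑ → Dom c ϑ ⊎ Dom d ϑ → ForcesMem x ϑ c ⇔ ForcesMem x ϑ d
              unfolded = λ ϑ k → to (forcesEq-unfold x c d xP) e ϑ k x x≤
          in ext
            (λ u uy →
              let a , ua , Xa = proj₂ (cert y c yc) u uy
                  v , b , vz , vb , ab = forcesMem-check x a z d xX zd
                    (to (unfolded a (inj₁ (X , Xa))) (forcesMem-pair x X a c Xa (below-top x xP)))
              in subst (_∈ z) (sym (ih u uy v a b ua vb ab)) vz)
            (λ v vz →
              let b , vb , Xb = proj₂ (cert z d zd) v vz
                  u , a , uy , ua , ba = forcesMem-check x b y c xX yc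
                    (from (unfolded b (inj₂ (X , Xb))) (forcesMem-pair x X b d Xb (below-top x xP)))
              in subst (_∈ y) (ih u uy v a b ua vb (forcesEq-sym x b a xP ba)) uy)

      opaque
        element-name : ∃[ ẋ ] IsName ẋ ×
          (∀ x c → Pair∈ M x c ẋ ⇔ (x ∈ X × (∃[ y ] y ∈ x × Pair∈ M y c G)))
        element-name =
          let S , lS , GS = level∋ G
              ẋ , pairs , hẋ = relation (∃̇ (v0 ∈̇ v1 ∧̇ pair∈ᶠ v0 v2 v3)) (G ∷ []) X S
          in ẋ ,
             name-intro ẋ (λ w i →
               let x , c , xX , _ , p = pairs w i
                   _ , _ , y , _ , yc = to (hẋ x c) (w , p , i)
               in x , c , ∈X⇒∈P xX , check-is-name y c yc , p) ,
             λ x c → mk⇔ (λ i → let xX , _ , h = to (hẋ x c) i in xX , h)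
               (λ { (xX , k@(y , _ , yc)) → from (hẋ x c) (xX , proj₂ (pair∈-transitive (level-transitive S lS) yc GS) , k) })

      opaque
        -- One set may have several check names in `G`, but by `check-separated` the atom `x` still
        -- determines `y`; hence a definable relation is already a function.
        choice-function : ∀ τ → (∀ x → x ∈ X → ∃[ y ] y ∈ x × (∃[ c ] Pair∈ M y c G × ForcesEq x τ c)) →
          ∃[ f ] IsFunctionOn M X f × (∀ x y → x ∈ X → Pair∈ M x y f → y ∈ x)
        choice-function τ h =
          let Y , hY = ⋃ X
              f , pairs , hf = relation
                (v1 ∈̇ v0 ∧̇ ∃̇ (pair∈ᶠ v2 v0 v4 ∧̇ forcesEqᶠ v5 v6 v1 v3 v0)) (τ ∷ G ∷ P ∷ R ∷ []) X Y
              unique : ∀ x → x ∈ X → ∀ y z → Pair∈ M x y f → Pair∈ M x z f → y ≡ z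
              unique = λ x xX y z i j →
                let _ , _ , _ , c , yc , e = to (hf x y) i
                    _ , _ , _ , d , zd , e' = to (hf x z) j
                    xP = ∈X⇒∈P xX
                in check-separated x xX y z c d yc zd (forcesEq-trans x c τ d xP (forcesEq-sym x τ c xP e) e')
          in f ,
             ( (λ z i → let x , y , xX , _ , p = pairs z i in x , y , xX , p)
             , (λ x xX → let y , yx , k = h x xX
                             i = from (hf x y) (xX , from (hY y) (x , yx , xX) , yx , k)
                         in y , i , λ {z} j → unique x xX y z i j)) ,
             λ x y xX i → proj₁ (proj₂ (proj₂ (to (hf x y) i)))

  MP⇒AC : MaximumPrinciple M → AC M
  MP⇒AC mp X nonempty with em {∃[ x ] x ∈ X}
  -- For empty `X` there is no atom, and the top forces nothing into `ẋ`; the empty function settles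
  -- this case.
  ... | no empty = proj₁ ∅ , ((λ z i → ⊥-elim (proj₂ ∅ z i)) , (λ x i → ⊥-elim (empty (x , i)))) ,
                   λ x y i → ⊥-elim (empty (x , i))
  ... | yes (x₀ , x₀X) = choice-function G cert τ chosen
    where
    open Antichain X
    open Order P R po
    Y : ∃[ Y ] (∀ z → z ∈ Y ⇔ (∃[ y ] z ∈ y × y ∈ X))
    Y = ⋃ X
    -- A certificate that covers `⋃ X` contains check names of its members, hence of every candidate
    -- `y ∈ x ∈ X`.
    certificate : ∃[ G ] Certificate X G × (∃[ c ] Pair∈ M (proj₁ Y) c G)
    certificate = certificate-exists X (proj₁ Y)
    G : Carrier
    G = proj₁ certificate
    cert : Certificate X G
    cert = proj₁ (proj₂ certificate)
    check : ∀ x y → x ∈ X → y ∈ x → ∃[ c ] Pair∈ M y c G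
    check x y xX yx =
      let c , i = proj₂ (proj₂ certificate)
          e , ye , _ = proj₂ (cert (proj₁ Y) c i) y (from (proj₂ Y y) (x , yx , xX))
      in e , ye
    ẋ : Carrier
    ẋ = proj₁ (element-name G cert)
    hẋ : ∀ x c → Pair∈ M x c ẋ ⇔ (x ∈ X × (∃[ y ] y ∈ x × Pair∈ M y c G))
    hẋ = proj₂ (proj₂ (element-name G cert))
    θ : Formula 2
    θ = v0 `∈ v1
    witness : ∀ q r → r ∈ X → r ⊴ q → ∃[ r ] r ⊴ q × (∃[ τ ] IsName τ × ForcesMem r τ ẋ)
    witness q r rX l =
      let y , yr = nonempty r rX ; c , yc = check r y rX yr in
      r , l , c , check-is-name G cert y c yc ,
      forcesMem-pair r r c ẋ (from (hẋ r c) (rX , y , yr , yc)) (⊴-refl r (∈X⇒∈P rX))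
    forces-∃ : Forces X (`∃ θ) (ẋ ∷ [])
    forces-∃ q l =
      -- An atom serves as its own extension; from the top any atom will do.
      [ (λ qX → witness q q qX (⊴-refl q (∈X⇒∈P qX)))
      , (λ q≡X → witness q x₀ x₀X (subst (x₀ ⊴_) (sym q≡X) (below-top x₀ (∈X⇒∈P x₀X)))) ]′
      (to (hP q) (proj₁ (⊴-dom l)))
    maximum : ∃[ τ ] IsName τ × Forces X θ (τ ∷ ẋ ∷ [])
    maximum = to (mp θ P R po X X∈P (ẋ ∷ []) (proj₁ (proj₂ (element-name G cert)) ∷ [])) forces-∃
    τ : Carrier
    τ = proj₁ maximum
    chosen : ∀ x → x ∈ X → ∃[ y ] y ∈ x × (∃[ c ] Pair∈ M y c G × ForcesEq x τ c)
    chosen x xX =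
      let s , c , i , xs , e = forcesMem-atom x τ ẋ xX
            (forcesMem-mono X x τ ẋ (below-top x (∈X⇒∈P xX)) (proj₂ (proj₂ maximum)))
          sX , y , ys , yc = to (hẋ s c) i
      -- The pair of `ẋ` found for `τ` has a condition `s ∈ X` above `x`; both are atoms, so `s` is
      -- `x` and `y ∈ s` becomes `y ∈ x`.
      in y , subst (y ∈_) (sym (atomic x s sX xs)) ys , c , yc , e

theorem2 : ∀ {ℓ} → ExcludedMiddle ℓ → (M : Structure ℓ) → ZF M →
    AC M ⇔ MaximumPrinciple M
theorem2 em M zf = record
  { to        = AC⇒MP
  ; from      = MP⇒AC
  ; to-cong   = cong AC⇒MP
  ; from-cong = cong MP⇒AC
  }
  where open CheckNames em M zf
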